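{- (i) Let $S\equiv\pm\{1, 5, 6, 8, 9, 10, 11, 13, 15, 19, 20, 23\}\pmod{48}$ and $T\equiv\pm\{1, 4, 5, 7, 9, 10, 15, 17, 18, 19, 20, 23\}\pmod{48}$. Then $p(S,n)=p(T,n-1)$ for all $n\geq 1$. (ii) Let $S\equiv\pm\{1, 2, 3, 4, 5, 6, 11, 13, 19, 20, 21, 23\}\pmod{48}$ and $T\equiv\pm\{1, 2, 3, 4, 5, 7, 8, 17, 18, 19, 21, 23\}\pmod{48}$. Then $p(S,n)=p(T,n)$ for all integers $n\ge0$ with $n\neq 6$. (iii) Let $S\equiv\pm\{4, 5, 6, 7, 8, 9, 11, 13, 15, 17, 19, 22\}\pmod{48}$ and $T\equiv\pm\{1, 4, 7, 9, 11, 13, 15, 17, 18, 20, 22, 23\}\pmod{48}$. Then $p(S,n)=p(T,n-4)$ for all $n\geq 4$. (iv) Let $S\equiv\pm\{3, 4, 5, 6, 7, 11, 13, 14, 17, 19, 20, 21\}\pmod{48}$ and $T\equiv\pm\{1, 3, 7, 8, 11, 13, 14, 17, 18, 20, 21, 23\}\pmod{48}$. Then $p(S,n)=p(T,n-3)$ for all $n\geq 3$.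
   Context: For a set $S$ of positive integers and an integer $n\ge 0$, $p(S,n)$ denotes the number of partitions of $n$ into parts belonging to $S$ (so $p(S,0)=1$). The notation $S\equiv\pm\{r_1,\dots,r_k\}\pmod M$ means that $S$ is the set of all positive integers $n$ such that $n\equiv r_i$ or $n\equiv -r_i\pmod M$ for some $i$. -}

module Defs where

open import Data.Nat using (ℕ; zero; suc; _+_; _*_; _∸_; _≤_; _<_; NonZero)
open import Data.Nat.Properties using (_≟_; _≤?_)
open import Data.Nat.DivMod using (_%_)
open import Data.List using (List; []; _∷_)
open import Data.Bool.ListAction using (any)
open import Data.Bool using (Bool; true; false; if_then_else_; _∧_; _∨_; not)
open import Relation.Nullary.Decidable using (⌊_⌋)

PartSet : Set
PartSet = ℕ → Bool

-- S ≡ ±{r₁,…,r_k} (mod M): the positive integers n with n ≡ rᵢ or n ≡ -rᵢ (mod M).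
-- n ≡ -r (mod M) is expressed as (n + r) % M ≡ 0.
pmSet : (M : ℕ) → .{{_ : NonZero M}} → List ℕ → PartSet
pmSet M rs zero = false
pmSet M rs (suc n) =
  any (λ r → ⌊ (suc n) % M ≟ r % M ⌋ ∨ ⌊ (suc n + r) % M ≟ 0 ⌋) rs

-- pb S k n : number of partitions of n into parts from S, all parts ≤ k.
-- Recursion on k, summing over the multiplicity m of the part k+1.
-- sumMult S k n m : contributions from multiplicities 0..m of part (suc k)
mutual
  pb : PartSet → ℕ → ℕ → ℕ
  pb S zero zero = 1
  pb S zero (suc n) = 0
  pb S (suc k) n = if S (suc k) then sumMult S k n n else pb S k n

  sumMult : PartSet → ℕ → ℕ → ℕ → ℕ
  sumMult S k n zero = pb S k n
  sumMult S k n (suc m) =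
    sumMult S k n m + (if ⌊ suc m * suc k ≤? n ⌋ then pb S k (n ∸ suc m * suc k) else 0)

p : PartSet → ℕ → ℕ
p S n = pb S n n

{-# OPTIONS --safe #-}

-- Write [r] = (q^r, q^(48-r); q^48)∞. Clearing denominators, each part of the theorem becomes
-- A - q^a B = q^c C, where A and B are products of four factors [r] and C is the product of
-- the [r] over S ∪ T. This follows by eliminating auxiliary products D, E, F from three
-- instances of Weierstrass' three-term relation for theta functions of nome q^24, which
-- connect (A, D, E), (B, D, F) and (C, E, F); they were found by a computer search.
--
-- Weierstrass' relation is the Plücker relation for 2 × 2 minors, since
-- f(a,b) f(c,d) = β₁ α₂ + s α₁ β₂ when ab = cd by a change of summation variables in ℤ², and
-- Jacobi's triple product turns Ramanujan's f(a,b) = Σ a^(z(z+1)/2) b^(z(z-1)/2) into a product.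
--
-- Everything takes place in a commutative ring with an element X such that X^M = 0, where the
-- sums and products are finite; ℤ[[X]] modulo X^M with M > n then gives the coefficient of X^n.

module Submission where

open import Defs
open import Algebra using (CommutativeRing; CommutativeSemiring)
import Algebra.Properties.Semiring.Exp as Exp
open import Data.Bool.Base using (Bool; true; false; if_then_else_; _∨_)
open import Data.Bool.ListAction using (or)
open import Data.Fin.Base using (toℕ)
open import Data.Integer.Base as ℤ using (ℤ; ∣_∣; _⊖_; -[1+_]) renaming (+_ to pos)
import Data.Integer.Properties as ℤ
open import Data.Integer.Solver using (module +-*-Solver)
open import Data.List.Base using (List; []; _∷_; _++_; map; filterᵇ; downFrom)
open import Data.List.Properties using (map-cong)
open import Data.List.Relation.Binary.Permutation.Propositional as ↭ using (_↭_)
open import Data.List.Relation.Unary.All as All using (All; []; _∷_)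
open import Data.Nat.Base as ℕ using (ℕ; zero; suc; _≤_; _<_; z≤n; s≤s)
open import Data.Nat.DivMod using (_%_; [m+n]%n≡m%n)
import Data.Nat.Properties as ℕ
open import Data.List.Sort.InsertionSort.Base ℕ.≤-decTotalOrder using (sort)
open import Data.List.Sort.InsertionSort.Properties ℕ.≤-decTotalOrder using (sort-↭)
open import Data.Product using (_×_; _,_; proj₁; proj₂)
open import Data.Sign.Base as Sign using (Sign)
open import Data.Sum.Base using (inj₁; inj₂)
open import Function.Base using (_∘_)
open import Function.Bundles using (mk⇔)
open import Level using (0ℓ)
open import Relation.Binary.PropositionalEquality as ≡ using (_≡_; _≢_; cong; cong₂; subst)
open import Relation.Nullary.Decidable
  using (True; toWitness; _×-dec_; ⌊_⌋; does-⇔; isYes≗does; dec-false; yes; no)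
open import Relation.Nullary.Negation using (contradiction)

-- Finitely supported sums over ℤ

-- Additively, for points u₁, ..., u₄ put T_ij = θ(u_i - u_j) θ(u_i + u_j). Ramanujan's formula
-- writes T_ij bilinearly in two theta series taken at u_i and at u_j, so the T_ij are, up to
-- monomials, the six minors of a 2 × 4 matrix. Differences u_i - u_j amount to square roots of
-- quotients of points; these are carried along as explicit signed monomials with a consistent
-- choice of signs.
--
-- Since 24 is half of 48, a theta factor with argument q^r is the product [r] [24 - r], but one
-- with argument -q^r is the quotient [2r] / ([r] [24 - r]). So each relation has denominators to
-- clear, and the extra factors must be cancelled again after the elimination. This is legitimate
-- modulo X^M because 1 - w is not a zero divisor when w is nilpotent. As signs and exponents are
-- concrete data, all side conditions of the relations are settled by evaluation.

∣i∣≤∣i+j∣+∣j∣ : ∀ i j → ∣ i ∣ ≤ ∣ i ℤ.+ j ∣ ℕ.+ ∣ j ∣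
∣i∣≤∣i+j∣+∣j∣ i j = begin
  ∣ i ∣                       ≡⟨ cong ∣_∣ (solve 2 (λ i j → i := (i :+ j) :+ :- j) ≡.refl i j) ⟩
  ∣ (i ℤ.+ j) ℤ.+ (ℤ.- j) ∣   ≤⟨ ℤ.∣i+j∣≤∣i∣+∣j∣ (i ℤ.+ j) (ℤ.- j) ⟩
  ∣ i ℤ.+ j ∣ ℕ.+ ∣ ℤ.- j ∣   ≡⟨ cong (∣ i ℤ.+ j ∣ ℕ.+_) (ℤ.∣-i∣≡∣i∣ j) ⟩
  ∣ i ℤ.+ j ∣ ℕ.+ ∣ j ∣       ∎
  where
  open ℕ.≤-Reasoning
  open +-*-Solver

module Sums {c ℓ} (R : CommutativeSemiring c ℓ) where
  open CommutativeSemiring R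
  open import Relation.Binary.Reasoning.Setoid setoid
  open import Algebra.Properties.Semiring.Sum semiring using (sum; *-distribˡ-sum; *-distribʳ-sum)
  open import Algebra.Properties.CommutativeMonoid.Sum +-commutativeMonoid using (∑-distrib-+; ∑-comm)
  open import Algebra.Properties.CommutativeSemigroup +-commutativeSemigroup
    using (interchange; x∙yz≈y∙xz)

  opaque
    ∑< : ℕ → (ℕ → Carrier) → Carrier
    ∑< n f = sum {n} (λ i → f (toℕ i))

    ∑<-cong : ∀ n {f g} → (∀ i → i < n → f i ≈ g i) → ∑< n f ≈ ∑< n g
    ∑<-cong zero    f≈g = refl
    ∑<-cong (suc n) f≈g = +-cong (f≈g 0 (s≤s z≤n)) (∑<-cong n (λ i i<n → f≈g (suc i) (s≤s i<n)))

    ∑<-zero : ∀ n {f} → (∀ i → f i ≈ 0#) → ∑< n f ≈ 0#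
    ∑<-zero zero    f≈0 = refl
    ∑<-zero (suc n) f≈0 = trans (+-cong (f≈0 0) (∑<-zero n (f≈0 ∘ suc))) (+-identityˡ 0#)

    ∑<-snoc : ∀ n f → ∑< (suc n) f ≈ ∑< n f + f n
    ∑<-snoc zero    f = +-comm _ _
    ∑<-snoc (suc n) f = trans (+-congˡ (∑<-snoc n (f ∘ suc))) (sym (+-assoc _ _ _))

    ∑<-truncate : ∀ {m n} f → m ≤ n → (∀ i → m ≤ i → f i ≈ 0#) → ∑< n f ≈ ∑< m f
    ∑<-truncate {n = n} f z≤n   f≈0 = ∑<-zero n (λ i → f≈0 i z≤n)
    ∑<-truncate f (s≤s m≤n) f≈0 = +-congˡ (∑<-truncate (f ∘ suc) m≤n (λ i m≤i → f≈0 (suc i) (s≤s m≤i)))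

    ∑<-pairs : ∀ n f → ∑< (n ℕ.+ n) f ≈ ∑< n (λ i → f (i ℕ.+ i) + f (suc (i ℕ.+ i)))
    ∑<-pairs zero    f = refl
    ∑<-pairs (suc n) f rewrite ℕ.+-suc n n = begin
      f 0 + (f 1 + ∑< (n ℕ.+ n) (f ∘ suc ∘ suc))
        ≈⟨ sym (+-assoc _ _ _) ⟩
      (f 0 + f 1) + ∑< (n ℕ.+ n) (f ∘ suc ∘ suc)
        ≈⟨ +-congˡ (∑<-pairs n (f ∘ suc ∘ suc)) ⟩
      (f 0 + f 1) + ∑< n (λ i → f (suc (suc (i ℕ.+ i))) + f (suc (suc (suc (i ℕ.+ i)))))
        ≈⟨ +-congˡ (∑<-cong n (λ i _ → reflexive (cong (λ k → f (suc k) + f (suc (suc k))) (≡.sym (ℕ.+-suc i i))))) ⟩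
      (f 0 + f 1) + ∑< n (λ i → f (suc i ℕ.+ suc i) + f (suc (suc i ℕ.+ suc i))) ∎

    ∑<-+ : ∀ n {f g} → ∑< n (λ i → f i + g i) ≈ ∑< n f + ∑< n g
    ∑<-+ n = ∑-distrib-+ {n} _ _

    ∑<-comm : ∀ m n {f : ℕ → ℕ → Carrier} → ∑< m (λ i → ∑< n (f i)) ≈ ∑< n (λ j → ∑< m (λ i → f i j))
    ∑<-comm m n = ∑-comm {m} {n} _

    *-∑< : ∀ x n {f} → x * ∑< n f ≈ ∑< n (λ i → x * f i)
    *-∑< x n = *-distribˡ-sum {n} x _

    ∑<-* : ∀ x n {f} → ∑< n f * x ≈ ∑< n (λ i → f i * x)
    ∑<-* x n = *-distribʳ-sum {n} x _

    ∑<-empty : ∀ f → ∑< 0 f ≈ 0#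
    ∑<-empty f = refl

    ∑<-cons : ∀ n f → ∑< (suc n) f ≈ f 0 + ∑< n (f ∘ suc)
    ∑<-cons n f = refl

  Vanishes : ℕ → (ℤ → Carrier) → Set ℓ
  Vanishes b f = ∀ z → b ≤ ∣ z ∣ → f z ≈ 0#

  vanishes-shift : ∀ {b f} k → Vanishes b f → Vanishes (b ℕ.+ ∣ k ∣) (λ z → f (z ℤ.+ k))
  vanishes-shift {b} k v z b+k≤z =
    v (z ℤ.+ k) (ℕ.+-cancelʳ-≤ _ _ _ (ℕ.≤-trans b+k≤z (∣i∣≤∣i+j∣+∣j∣ z k)))

  opaque
    -- The window is half-open, -n ≤ z < n, so that doubling it splits it exactly into even and odd
    -- z. The price is that a reflection or a shift by one trades the term at -n for the one at n,
    -- and both have to vanish.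
    ∑ℤ : ℕ → (ℤ → Carrier) → Carrier
    ∑ℤ n f = ∑< n (λ i → f (pos i)) + ∑< n (λ i → f -[1+ i ])

    ∑ℤ-cong : ∀ n {f g} → (∀ z → ∣ z ∣ ≤ n → f z ≈ g z) → ∑ℤ n f ≈ ∑ℤ n g
    ∑ℤ-cong n f≈g = +-cong (∑<-cong n (λ i i<n → f≈g (pos i) (ℕ.<⇒≤ i<n)))
                           (∑<-cong n (λ i i<n → f≈g -[1+ i ] i<n))

    ∑ℤ-truncate : ∀ {b n f} → Vanishes b f → b ≤ n → ∑ℤ n f ≈ ∑ℤ b f
    ∑ℤ-truncate v b≤n = +-cong (∑<-truncate _ b≤n (λ i b≤i → v (pos i) b≤i))
                               (∑<-truncate _ b≤n (λ i b≤i → v -[1+ i ] (ℕ.m≤n⇒m≤1+n b≤i)))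

    ∑ℤ-+ : ∀ n f g → ∑ℤ n (λ z → f z + g z) ≈ ∑ℤ n f + ∑ℤ n g
    ∑ℤ-+ n f g = trans (+-cong (∑<-+ n) (∑<-+ n)) (interchange _ _ _ _)

    *-∑ℤ : ∀ x n f → x * ∑ℤ n f ≈ ∑ℤ n (λ z → x * f z)
    *-∑ℤ x n f = trans (distribˡ x _ _) (+-cong (*-∑< x n) (*-∑< x n))

    ∑ℤ-* : ∀ x n f → ∑ℤ n f * x ≈ ∑ℤ n (λ z → f z * x)
    ∑ℤ-* x n f = trans (distribʳ x _ _) (+-cong (∑<-* x n) (∑<-* x n))

    ∑ℤ-comm : ∀ m n (f : ℤ → ℤ → Carrier) →
              ∑ℤ m (λ x → ∑ℤ n (λ y → f x y)) ≈ ∑ℤ n (λ y → ∑ℤ m (λ x → f x y))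
    ∑ℤ-comm m n f = begin
      ∑< m (λ i → ∑< n (λ j → f (pos i) (pos j)) + ∑< n (λ j → f (pos i) -[1+ j ]))
        + ∑< m (λ i → ∑< n (λ j → f -[1+ i ] (pos j)) + ∑< n (λ j → f -[1+ i ] -[1+ j ]))
        ≈⟨ +-cong (∑<-+ m) (∑<-+ m) ⟩
      (∑< m (λ i → ∑< n (λ j → f (pos i) (pos j))) + ∑< m (λ i → ∑< n (λ j → f (pos i) -[1+ j ])))
        + (∑< m (λ i → ∑< n (λ j → f -[1+ i ] (pos j))) + ∑< m (λ i → ∑< n (λ j → f -[1+ i ] -[1+ j ])))
        ≈⟨ +-cong (+-cong (∑<-comm m n) (∑<-comm m n)) (+-cong (∑<-comm m n) (∑<-comm m n)) ⟩
      (∑< n (λ j → ∑< m (λ i → f (pos i) (pos j))) + ∑< n (λ j → ∑< m (λ i → f (pos i) -[1+ j ])))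
        + (∑< n (λ j → ∑< m (λ i → f -[1+ i ] (pos j))) + ∑< n (λ j → ∑< m (λ i → f -[1+ i ] -[1+ j ])))
        ≈⟨ interchange _ _ _ _ ⟩
      (∑< n (λ j → ∑< m (λ i → f (pos i) (pos j))) + ∑< n (λ j → ∑< m (λ i → f -[1+ i ] (pos j))))
        + (∑< n (λ j → ∑< m (λ i → f (pos i) -[1+ j ])) + ∑< n (λ j → ∑< m (λ i → f -[1+ i ] -[1+ j ])))
        ≈⟨ +-cong (∑<-+ n) (∑<-+ n) ⟨
      ∑ℤ n (λ y → ∑ℤ m (λ x → f x y)) ∎

    ∑ℤ-suc : ∀ n f → f (pos n) ≈ 0# → f (ℤ.- (pos n)) ≈ 0# → ∑ℤ n (f ∘ ℤ.suc) ≈ ∑ℤ n f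
    ∑ℤ-suc zero    f _ _ = +-cong (trans (∑<-empty _) (sym (∑<-empty _))) (trans (∑<-empty _) (sym (∑<-empty _)))
    ∑ℤ-suc (suc n) f f₊≈0 f₋≈0 = begin
      ∑< (suc n) (λ i → f (pos (suc i))) + ∑< (suc n) (λ i → f (ℤ.suc -[1+ i ]))
        ≈⟨ +-cong (trans (∑<-snoc n _) (trans (+-congˡ f₊≈0) (+-identityʳ _))) (∑<-cons n _) ⟩
      ∑< n (λ i → f (pos (suc i))) + (f (pos 0) + ∑< n (λ i → f -[1+ i ]))
        ≈⟨ x∙yz≈y∙xz _ _ _ ⟩
      f (pos 0) + (∑< n (λ i → f (pos (suc i))) + ∑< n (λ i → f -[1+ i ]))
        ≈⟨ +-assoc _ _ _ ⟨
      (f (pos 0) + ∑< n (λ i → f (pos (suc i)))) + ∑< n (λ i → f -[1+ i ])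
        ≈⟨ +-cong (∑<-cons n _) (trans (∑<-snoc n _) (trans (+-congˡ f₋≈0) (+-identityʳ _))) ⟨
      ∑< (suc n) (λ i → f (pos i)) + ∑< (suc n) (λ i → f -[1+ i ]) ∎

    ∑ℤ-neg : ∀ n f → f (pos n) ≈ 0# → f (ℤ.- (pos n)) ≈ 0# → ∑ℤ n (f ∘ ℤ.-_) ≈ ∑ℤ n f
    ∑ℤ-neg zero    f _ _ = +-cong (trans (∑<-empty _) (sym (∑<-empty _))) (trans (∑<-empty _) (sym (∑<-empty _)))
    ∑ℤ-neg (suc n) f f₊≈0 f₋≈0 = begin
      ∑< (suc n) (λ i → f (ℤ.- pos i)) + ∑< (suc n) (λ i → f (pos (suc i)))
        ≈⟨ +-cong (∑<-cons n _) (trans (∑<-snoc n _) (trans (+-congˡ f₊≈0) (+-identityʳ _))) ⟩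
      (f (pos 0) + ∑< n (λ i → f -[1+ i ])) + ∑< n (λ i → f (pos (suc i)))
        ≈⟨ trans (+-assoc _ _ _) (trans (+-congˡ (+-comm _ _)) (sym (+-assoc _ _ _))) ⟩
      (f (pos 0) + ∑< n (λ i → f (pos (suc i)))) + ∑< n (λ i → f -[1+ i ])
        ≈⟨ +-cong (∑<-cons n _) (trans (∑<-snoc n _) (trans (+-congˡ f₋≈0) (+-identityʳ _))) ⟨
      ∑< (suc n) (λ i → f (pos i)) + ∑< (suc n) (λ i → f -[1+ i ]) ∎

    ∑ℤ-halves : ∀ n f → ∑ℤ n f ≈ ∑< n (λ i → f (pos i)) + ∑< n (λ i → f -[1+ i ])
    ∑ℤ-halves n f = refl

    ∑ℤ-parity : ∀ n f → ∑ℤ (n ℕ.+ n) f ≈ ∑ℤ n (λ t → f (t ℤ.+ t) + f (ℤ.suc (t ℤ.+ t)))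
    -- For t = -(i + 1), `-[1+_]` of 2i is `ℤ.suc (t ℤ.+ t)` and `-[1+_]` of 2i + 1 is `t ℤ.+ t`;
    -- hence the swap on the negative half.
    ∑ℤ-parity n f = +-cong (∑<-pairs n _) (trans (∑<-pairs n _) (∑<-cong n (λ i _ → +-comm _ _)))

  ∑ℤ-shift⁺ : ∀ {b n f} k → Vanishes b f → b ℕ.+ k ≤ n → ∑ℤ n (λ z → f (z ℤ.+ pos k)) ≈ ∑ℤ n f
  ∑ℤ-shift⁺ {n = n} {f} zero v b+k≤n = ∑ℤ-cong n (λ z _ → reflexive (cong f (ℤ.+-identityʳ z)))
  ∑ℤ-shift⁺ {b} {n} {f} (suc k) v b+k≤n = begin
    ∑ℤ n (λ z → f (z ℤ.+ pos (suc k)))       ≈⟨ ∑ℤ-cong n (λ z _ → reflexive (cong f (z+suc z))) ⟩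
    ∑ℤ n (λ z → f (ℤ.suc z ℤ.+ pos k))     ≈⟨ ∑ℤ-suc n (λ z → f (z ℤ.+ pos k)) (w (pos n) b+k≤n′)
                                              (w (ℤ.- pos n) (subst (b ℕ.+ k ≤_) (≡.sym (ℤ.∣-i∣≡∣i∣ (pos n))) b+k≤n′)) ⟩
    ∑ℤ n (λ z → f (z ℤ.+ pos k))           ≈⟨ ∑ℤ-shift⁺ k v b+k≤n′ ⟩
    ∑ℤ n f                               ∎
    where
    w : Vanishes (b ℕ.+ k) (λ z → f (z ℤ.+ pos k))
    w = vanishes-shift (pos k) v
    b+k≤n′ : b ℕ.+ k ≤ n
    b+k≤n′ = ℕ.≤-trans (ℕ.+-monoʳ-≤ b (ℕ.n≤1+n k)) b+k≤n
    z+suc : ∀ z → z ℤ.+ pos (suc k) ≡ ℤ.suc z ℤ.+ pos k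
    z+suc z = ≡.trans (≡.sym (ℤ.+-assoc z (pos 1) (pos k))) (cong (λ i → i ℤ.+ pos k) (ℤ.+-comm z (pos 1)))

  ∑ℤ-shift : ∀ {b n f} k → Vanishes b f → b ℕ.+ ∣ k ∣ ≤ n → ∑ℤ n (λ z → f (z ℤ.+ k)) ≈ ∑ℤ n f
  ∑ℤ-shift (pos k) = ∑ℤ-shift⁺ k
  ∑ℤ-shift {b} {n} {f} -[1+ k ] v b+k≤n = begin
    ∑ℤ n (λ z → f (z ℤ.+ -[1+ k ]))
      ≈⟨ ∑ℤ-shift⁻ (suc k) b+k≤n ⟩
    ∑ℤ n f ∎
    where
    -suc : ∀ z k → ℤ.suc z ℤ.+ (ℤ.- pos (suc k)) ≡ z ℤ.+ (ℤ.- pos k)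
    -suc z k = ≡.trans (cong (ℤ._+ (ℤ.- pos (suc k))) (ℤ.+-comm (pos 1) z))
               (≡.trans (ℤ.+-assoc z (pos 1) (ℤ.- pos (suc k))) (cong (ℤ._+_ z) (1-suc k)))
      where
      1-suc : ∀ k → pos 1 ℤ.+ (ℤ.- pos (suc k)) ≡ ℤ.- pos k
      1-suc zero    = ≡.refl
      1-suc (suc k) = ≡.refl
    ∑ℤ-shift⁻ : ∀ k → b ℕ.+ k ≤ n → ∑ℤ n (λ z → f (z ℤ.+ (ℤ.- pos k))) ≈ ∑ℤ n f
    ∑ℤ-shift⁻ zero    _      = ∑ℤ-cong n (λ z _ → reflexive (cong f (ℤ.+-identityʳ z)))
    ∑ℤ-shift⁻ (suc k) b+k≤n = begin
      ∑ℤ n (λ z → f (z ℤ.+ (ℤ.- pos (suc k))))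
        ≈⟨ ∑ℤ-suc n _ (w (pos n) b+k≤n) (w (ℤ.- pos n) (subst (b ℕ.+ suc k ≤_) (≡.sym (ℤ.∣-i∣≡∣i∣ (pos n))) b+k≤n)) ⟨
      ∑ℤ n (λ z → f (ℤ.suc z ℤ.+ (ℤ.- pos (suc k))))
        ≈⟨ ∑ℤ-cong n (λ z _ → reflexive (cong f (-suc z k))) ⟩
      ∑ℤ n (λ z → f (z ℤ.+ (ℤ.- pos k)))
        ≈⟨ ∑ℤ-shift⁻ k (ℕ.≤-trans (ℕ.+-monoʳ-≤ b (ℕ.n≤1+n k)) b+k≤n) ⟩
      ∑ℤ n f ∎
      where
      w : Vanishes (b ℕ.+ suc k) (λ z → f (z ℤ.+ (ℤ.- pos (suc k))))
      w = vanishes-shift -[1+ k ] v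

  -- The change of variables on ℤ² sends (m , n) to (s , t) with m + n = 2 t or
  -- m + n = 2 t + 1.
  ∑ℤ-product : ∀ {b f g} → Vanishes b f → Vanishes b g → let n = b ℕ.+ suc b in
    ∑ℤ b f * ∑ℤ b g ≈
    ∑ℤ b (λ t → ∑ℤ n (λ s → f (s ℤ.+ t) * g (t ℤ.- s))) +
    ∑ℤ b (λ t → ∑ℤ n (λ s → f (s ℤ.+ ℤ.suc t) * g (t ℤ.- s)))
  ∑ℤ-product {b} {f} {g} vf vg = begin
    ∑ℤ b f * ∑ℤ b g
      ≈⟨ ∑ℤ-* _ b f ⟩
    ∑ℤ b (λ m → f m * ∑ℤ b g)
      ≈⟨ ∑ℤ-cong b (λ m ∣m∣≤b → trans (*-congˡ (inner m ∣m∣≤b)) (*-∑ℤ _ (b ℕ.+ b) _)) ⟩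
    ∑ℤ b (λ m → ∑ℤ (b ℕ.+ b) (λ v → h v m))
      ≈⟨ ∑ℤ-comm b (b ℕ.+ b) _ ⟩
    ∑ℤ (b ℕ.+ b) (λ v → ∑ℤ b (h v))
      ≈⟨ ∑ℤ-parity b _ ⟩
    ∑ℤ b (λ t → ∑ℤ b (h (t ℤ.+ t)) + ∑ℤ b (h (ℤ.suc (t ℤ.+ t))))
      ≈⟨ ∑ℤ-cong b (λ t ∣t∣≤b → +-cong (even t ∣t∣≤b) (odd t ∣t∣≤b)) ⟩
    ∑ℤ b (λ t → ∑ℤ (b ℕ.+ suc b) (λ s → f (s ℤ.+ t) * g (t ℤ.- s)) +
                ∑ℤ (b ℕ.+ suc b) (λ s → f (s ℤ.+ ℤ.suc t) * g (t ℤ.- s)))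
      ≈⟨ ∑ℤ-+ b _ _ ⟩
    _ ∎
    where
    h : ℤ → ℤ → Carrier
    h v m = f m * g (v ℤ.- m)
    vh : ∀ v → Vanishes b (h v)
    vh v m b≤m = trans (*-congʳ (vf m b≤m)) (zeroˡ _)
    inner : ∀ m → ∣ m ∣ ≤ b → ∑ℤ b g ≈ ∑ℤ (b ℕ.+ b) (λ v → g (v ℤ.- m))
    inner m ∣m∣≤b = sym (trans
      (∑ℤ-shift (ℤ.- m) vg (ℕ.+-monoʳ-≤ b (ℕ.≤-trans (ℕ.≤-reflexive (ℤ.∣-i∣≡∣i∣ m)) ∣m∣≤b)))
      (∑ℤ-truncate vg (ℕ.m≤m+n b b)))
    -- In the odd case the shift is `ℤ.suc t`, bounded only by `suc b`; this fixes the inner range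
    -- `b ℕ.+ suc b`.
    shifted : ∀ v k → ∣ k ∣ ≤ suc b → ∑ℤ b (h v) ≈ ∑ℤ (b ℕ.+ suc b) (λ s → h v (s ℤ.+ k))
    shifted v k ∣k∣≤b = sym (trans (∑ℤ-shift k (vh v) (ℕ.+-monoʳ-≤ b ∣k∣≤b)) (∑ℤ-truncate (vh v) (ℕ.m≤m+n b _)))
    open +-*-Solver
    even : ∀ t → ∣ t ∣ ≤ b → ∑ℤ b (h (t ℤ.+ t)) ≈ ∑ℤ (b ℕ.+ suc b) (λ s → f (s ℤ.+ t) * g (t ℤ.- s))
    even t ∣t∣≤b = trans (shifted (t ℤ.+ t) t (ℕ.m≤n⇒m≤1+n ∣t∣≤b))
      (∑ℤ-cong _ (λ s _ → *-congˡ (reflexive (cong g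
        (solve 2 (λ t s → (t :+ t) :- (s :+ t) := t :- s) ≡.refl t s)))))
    odd : ∀ t → ∣ t ∣ ≤ b → ∑ℤ b (h (ℤ.suc (t ℤ.+ t))) ≈ ∑ℤ (b ℕ.+ suc b) (λ s → f (s ℤ.+ ℤ.suc t) * g (t ℤ.- s))
    odd t ∣t∣≤b = trans (shifted (ℤ.suc (t ℤ.+ t)) (ℤ.suc t) (ℕ.≤-trans (ℤ.∣i+j∣≤∣i∣+∣j∣ (pos 1) t) (s≤s ∣t∣≤b)))
      (∑ℤ-cong _ (λ s _ → *-congˡ (reflexive (cong g
        (solve 2 (λ t s → (con (pos 1) :+ (t :+ t)) :- (s :+ (con (pos 1) :+ t)) := t :- s) ≡.refl t s)))))

-- Ramanujan's theta function

tri : ℕ → ℕ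
tri zero    = 0
tri (suc n) = suc n ℕ.+ tri n

-- △ z = z (z + 1) / 2
△ : ℤ → ℕ
△ (pos n)  = tri n
△ -[1+ n ] = tri n

2*tri : ∀ n → pos (tri n) ℤ.* pos 2 ≡ pos n ℤ.* ℤ.suc (pos n)
2*tri zero    = ≡.refl
2*tri (suc n) = begin
  pos (suc n ℕ.+ tri n) ℤ.* pos 2
    ≡⟨ solve 2 (λ n t → (con (pos 1) :+ n :+ t) :* con (pos 2) := (con (pos 1) :+ n) :* con (pos 2) :+ t :* con (pos 2)) ≡.refl (pos n) (pos (tri n)) ⟩
  pos (suc n) ℤ.* pos 2 ℤ.+ pos (tri n) ℤ.* pos 2
    ≡⟨ cong (ℤ._+_ (pos (suc n) ℤ.* pos 2)) (2*tri n) ⟩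
  pos (suc n) ℤ.* pos 2 ℤ.+ pos n ℤ.* ℤ.suc (pos n)
    ≡⟨ solve 1 (λ n → (con (pos 1) :+ n) :* con (pos 2) :+ n :* (con (pos 1) :+ n) := (con (pos 1) :+ n) :* (con (pos 1) :+ (con (pos 1) :+ n))) ≡.refl (pos n) ⟩
  pos (suc n) ℤ.* ℤ.suc (pos (suc n)) ∎
  where
  open ≡.≡-Reasoning
  open +-*-Solver

2*△ : ∀ z → pos (△ z) ℤ.* pos 2 ≡ z ℤ.* ℤ.suc z
2*△ (pos n)  = 2*tri n
2*△ -[1+ n ] = begin
  pos (tri n) ℤ.* pos 2            ≡⟨ 2*tri n ⟩
  pos n ℤ.* ℤ.suc (pos n)          ≡⟨ solve 1 (λ n → n :* (con (pos 1) :+ n) := (:- (con (pos 1) :+ n)) :* (con (pos 1) :+ (:- (con (pos 1) :+ n)))) ≡.refl (pos n) ⟩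
  -[1+ n ] ℤ.* ℤ.suc (-[1+ n ])    ∎
  where
  open ≡.≡-Reasoning
  open +-*-Solver

-- Linear identities between values of △ are reduced to polynomial identities over ℤ.
combo : List (ℕ × ℤ) → ℕ
combo []             = 0
combo ((k , z) ∷ zs) = k ℕ.* △ z ℕ.+ combo zs

comboℤ : List (ℕ × ℤ) → ℤ
comboℤ []             = pos 0
comboℤ ((k , z) ∷ zs) = pos k ℤ.* (z ℤ.* ℤ.suc z) ℤ.+ comboℤ zs

2*combo : ∀ zs → pos (combo zs) ℤ.* pos 2 ≡ comboℤ zs
2*combo []             = ≡.refl
2*combo ((k , z) ∷ zs) = begin
  pos (k ℕ.* △ z ℕ.+ combo zs) ℤ.* pos 2
    ≡⟨ cong (ℤ._* pos 2) (≡.trans (ℤ.pos-+ (k ℕ.* △ z) _) (cong (ℤ._+ pos (combo zs)) (ℤ.pos-* k (△ z)))) ⟩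
  (pos k ℤ.* pos (△ z) ℤ.+ pos (combo zs)) ℤ.* pos 2
    ≡⟨ solve 3 (λ k t c → (k :* t :+ c) :* con (pos 2) := k :* (t :* con (pos 2)) :+ c :* con (pos 2)) ≡.refl (pos k) (pos (△ z)) (pos (combo zs)) ⟩
  pos k ℤ.* (pos (△ z) ℤ.* pos 2) ℤ.+ pos (combo zs) ℤ.* pos 2
    ≡⟨ cong₂ (λ x y → pos k ℤ.* x ℤ.+ y) (2*△ z) (2*combo zs) ⟩
  comboℤ ((k , z) ∷ zs) ∎
  where
  open ≡.≡-Reasoning
  open +-*-Solver

combo-≡ : ∀ zs ws → comboℤ zs ≡ comboℤ ws → combo zs ≡ combo ws
combo-≡ zs ws eq = ℤ.+-injective (ℤ.*-cancelʳ-≡ (pos (combo zs)) (pos (combo ws)) (pos 2)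
  (≡.trans (2*combo zs) (≡.trans eq (≡.sym (2*combo ws)))))

-- Describes the exponent of one variable in a product of two theta terms at s and t, when the
-- variable occurs in the four bases to the powers x, x′, y, y′.
±± : ℕ → ℕ → ℤ → ℕ → ℕ → ℤ → List (ℕ × ℤ)
±± x x′ s y y′ t = (x , s) ∷ (x′ , ℤ.- s) ∷ (y , t) ∷ (y′ , ℤ.- t) ∷ []

module _ where
  open +-*-Solver

  -- Mirrors `comboℤ` in the syntax of the solver, so that a solved equation evaluates to an
  -- equation between values of `comboℤ`.
  ⟪_⟫ : ∀ {n} → List (ℕ × Polynomial n) → Polynomial n
  ⟪ [] ⟫           = con (pos 0)
  ⟪ (k , p) ∷ ps ⟫ = con (pos k) :* (p :* (con (pos 1) :+ p)) :+ ⟪ ps ⟫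

  ±±ₚ : ∀ {n} → ℕ → ℕ → Polynomial n → ℕ → ℕ → Polynomial n → List (ℕ × Polynomial n)
  ±±ₚ x x′ s y y′ t = (x , s) ∷ (x′ , :- s) ∷ (y , t) ∷ (y′ , :- t) ∷ []

n≤tri : ∀ n → n ≤ tri n
n≤tri zero    = z≤n
n≤tri (suc n) = ℕ.m≤m+n (suc n) (tri n)

-- On the negative side △ of -(n + 1) is only `tri n`; this is the origin of the `suc l` in the
-- ranges of the theta series.
△-large : ∀ l z → suc l ≤ ∣ z ∣ → l ≤ △ z
△-large l (pos n)  l<z = ℕ.≤-trans (ℕ.<⇒≤ l<z) (n≤tri n)
△-large l -[1+ n ] l<z = ℕ.≤-trans (ℕ.≤-pred l<z) (n≤tri n)

module Theta {c ℓ} (R : CommutativeSemiring c ℓ) where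
  open CommutativeSemiring R
  open Sums R
  open import Algebra.Properties.Semiring.Exp semiring
  open import Algebra.Properties.CommutativeSemiring.Exp R using (^-distrib-*)
  open import Algebra.Properties.CommutativeSemigroup *-commutativeSemigroup using (interchange)
  open import Relation.Binary.Reasoning.Setoid setoid
  open import Algebra.Solver.Ring.NaturalCoefficients.Default R using (Polynomial; solve; _:=_; _:+_; _:*_; _:^_)

  term : Carrier → Carrier → ℤ → Carrier
  term a b z = a ^ △ z * b ^ △ (ℤ.- z)

  term-cong : ∀ {a a′ b b′} → a ≈ a′ → b ≈ b′ → ∀ z → term a b z ≈ term a′ b′ z
  term-cong a≈a′ b≈b′ z = *-cong (^-congˡ (△ z) a≈a′) (^-congˡ (△ (ℤ.- z)) b≈b′)

  ^-vanish : ∀ {x m n} → m ≤ n → x ^ m ≈ 0# → x ^ n ≈ 0#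
  ^-vanish {x} {m} {n} m≤n xᵐ≈0 = begin
    x ^ n                    ≡⟨ cong (x ^_) (≡.sym (ℕ.m+[n∸m]≡n m≤n)) ⟩
    x ^ (m ℕ.+ (n ℕ.∸ m))    ≈⟨ ^-homo-* x m _ ⟩
    x ^ m * x ^ (n ℕ.∸ m)    ≈⟨ *-congʳ xᵐ≈0 ⟩
    0# * x ^ (n ℕ.∸ m)       ≈⟨ zeroˡ _ ⟩
    0# ∎

  ^*^-vanish : ∀ {a b l m n} → l ≤ m → l ≤ n → (a * b) ^ l ≈ 0# → a ^ m * b ^ n ≈ 0#
  ^*^-vanish {a} {b} {l} {m} {n} l≤m l≤n abˡ≈0 = begin
    a ^ m * b ^ n                                            ≡⟨ cong₂ (λ i j → a ^ i * b ^ j) (≡.sym (ℕ.m+[n∸m]≡n l≤m)) (≡.sym (ℕ.m+[n∸m]≡n l≤n)) ⟩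
    a ^ (l ℕ.+ (m ℕ.∸ l)) * b ^ (l ℕ.+ (n ℕ.∸ l))            ≈⟨ *-cong (^-homo-* a l _) (^-homo-* b l _) ⟩
    (a ^ l * a ^ (m ℕ.∸ l)) * (b ^ l * b ^ (n ℕ.∸ l))        ≈⟨ interchange _ _ _ _ ⟩
    (a ^ l * b ^ l) * (a ^ (m ℕ.∸ l) * b ^ (n ℕ.∸ l))        ≈⟨ *-congʳ (trans (sym (^-distrib-* a b l)) abˡ≈0) ⟩
    0# * (a ^ (m ℕ.∸ l) * b ^ (n ℕ.∸ l))                     ≈⟨ zeroˡ _ ⟩
    0# ∎

  -- Both exponents are at least l, so the term is a multiple of (ab)^l. Nilpotence is asked of the
  -- product ab because a single base may be a unit: a point of exponent 24 has a partner of
  -- exponent 0.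
  term-vanishes : ∀ {l a b} → (a * b) ^ l ≈ 0# → Vanishes (suc l) (term a b)
  term-vanishes {l} abˡ≈0 z l<z = ^*^-vanish (△-large l z l<z)
    (△-large l (ℤ.- z) (subst (suc l ≤_) (≡.sym (ℤ.∣-i∣≡∣i∣ z)) l<z)) abˡ≈0

  -- Ramanujan's f(a,b), in a ring where the terms with |z| > l vanish.
  𝕗 : ℕ → Carrier → Carrier → Carrier
  𝕗 l a b = ∑ℤ (suc l) (term a b)

  𝕗-cong : ∀ l {a a′ b b′} → a ≈ a′ → b ≈ b′ → 𝕗 l a b ≈ 𝕗 l a′ b′
  𝕗-cong l a≈a′ b≈b′ = ∑ℤ-cong (suc l) (λ z _ → term-cong a≈a′ b≈b′ z)

  private
    module I = +-*-Solver
    open I using (con) renaming (_:+_ to _⊕_; _:-_ to _⊖ᵢ_; _:=_ to _≐_)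

  module Schröter (a h k : Carrier) where
    mon : ℕ → ℕ → ℕ → Carrier
    mon x y z = a ^ x * (h ^ y * k ^ z)

    mon-* : ∀ x y z x′ y′ z′ → mon x y z * mon x′ y′ z′ ≈ mon (x ℕ.+ x′) (y ℕ.+ y′) (z ℕ.+ z′)
    mon-* x y z x′ y′ z′ = begin
      (a ^ x * (h ^ y * k ^ z)) * (a ^ x′ * (h ^ y′ * k ^ z′))     ≈⟨ interchange _ _ _ _ ⟩
      (a ^ x * a ^ x′) * ((h ^ y * k ^ z) * (h ^ y′ * k ^ z′))     ≈⟨ *-congˡ (interchange _ _ _ _) ⟩
      (a ^ x * a ^ x′) * ((h ^ y * h ^ y′) * (k ^ z * k ^ z′))
        ≈⟨ *-cong (^-homo-* a x x′) (*-cong (^-homo-* h y y′) (^-homo-* k z z′)) ⟨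
      mon (x ℕ.+ x′) (y ℕ.+ y′) (z ℕ.+ z′) ∎

    mon-^ : ∀ x y z n → mon x y z ^ n ≈ mon (x ℕ.* n) (y ℕ.* n) (z ℕ.* n)
    mon-^ x y z n = begin
      mon x y z ^ n                                   ≈⟨ ^-distrib-* _ _ n ⟩
      (a ^ x) ^ n * (h ^ y * k ^ z) ^ n               ≈⟨ *-congˡ (^-distrib-* _ _ n) ⟩
      (a ^ x) ^ n * ((h ^ y) ^ n * (k ^ z) ^ n)       ≈⟨ *-cong (^-assocʳ a x n) (*-cong (^-assocʳ h y n) (^-assocʳ k z n)) ⟩
      mon (x ℕ.* n) (y ℕ.* n) (z ℕ.* n) ∎

    mon-≡ : ∀ {x y z x′ y′ z′} → x ≡ x′ → y ≡ y′ → z ≡ z′ → mon x y z ≈ mon x′ y′ z′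
    mon-≡ ≡.refl ≡.refl ≡.refl = refl

    termₘ : (x y z x′ y′ z′ : ℕ) → ℤ → Carrier
    termₘ x y z x′ y′ z′ = term (mon x y z) (mon x′ y′ z′)

    term²-mon : ∀ x y z x′ y′ z′ s u v w u′ v′ w′ t →
      termₘ x y z x′ y′ z′ s * termₘ u v w u′ v′ w′ t ≈
      mon (combo (±± x x′ s u u′ t)) (combo (±± y y′ s v v′ t)) (combo (±± z z′ s w w′ t))
    term²-mon x y z x′ y′ z′ s u v w u′ v′ w′ t = begin
      (mon x y z ^ △ s * mon x′ y′ z′ ^ △ (ℤ.- s)) * (mon u v w ^ △ t * mon u′ v′ w′ ^ △ (ℤ.- t))
        ≈⟨ *-cong (*-cong (mon-^ x y z (△ s)) (mon-^ x′ y′ z′ (△ (ℤ.- s))))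
                  (*-cong (mon-^ u v w (△ t)) (mon-^ u′ v′ w′ (△ (ℤ.- t)))) ⟩
      _
        ≈⟨ *-cong (mon-* (x ℕ.* △ s) (y ℕ.* △ s) (z ℕ.* △ s) _ _ _) (mon-* (u ℕ.* △ t) (v ℕ.* △ t) (w ℕ.* △ t) _ _ _) ⟩
      _
        ≈⟨ mon-* (x ℕ.* △ s ℕ.+ x′ ℕ.* △ (ℤ.- s)) (y ℕ.* △ s ℕ.+ y′ ℕ.* △ (ℤ.- s)) (z ℕ.* △ s ℕ.+ z′ ℕ.* △ (ℤ.- s)) _ _ _ ⟩
      _
        ≈⟨ mon-≡ (assoc4 (x ℕ.* △ s) _ (u ℕ.* △ t) _) (assoc4 (y ℕ.* △ s) _ (v ℕ.* △ t) _) (assoc4 (z ℕ.* △ s) _ (w ℕ.* △ t) _) ⟩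
      mon (combo (±± x x′ s u u′ t)) (combo (±± y y′ s v v′ t)) (combo (±± z z′ s w w′ t)) ∎
      where
      assoc4 : ∀ p q r s → (p ℕ.+ q) ℕ.+ (r ℕ.+ s) ≡ p ℕ.+ (q ℕ.+ (r ℕ.+ (s ℕ.+ 0)))
      assoc4 p q r s rewrite ℕ.+-identityʳ s = ℕ.+-assoc p q (r ℕ.+ s)

    -- Because the two theta series have the same product of bases, the quadratic part of the
    -- exponent is a multiple of (s + t)² + (t - s)², which has no mixed term; so s and t separate.
    -- The three exponents, of `a`, `h` and `k`, are compared one by one.
    even-term : ∀ s t →
      termₘ 1 0 0 1 1 1 (s ℤ.+ t) * termₘ 1 0 1 1 1 0 (t ℤ.- s) ≈
      termₘ 2 1 0 2 1 2 s * termₘ 2 0 1 2 2 1 t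
    even-term s t = trans (term²-mon 1 0 0 1 1 1 (s ℤ.+ t) 1 0 1 1 1 0 (t ℤ.- s)) (trans (mon-≡
      (exp-≡ 1 1 1 1 2 2 2 2 (I.solve 2 (λ s t → ⟪ ±±ₚ 1 1 (s ⊕ t) 1 1 (t ⊖ᵢ s) ⟫ ≐ ⟪ ±±ₚ 2 2 s 2 2 t ⟫) ≡.refl s t))
      (exp-≡ 0 1 0 1 1 1 0 2 (I.solve 2 (λ s t → ⟪ ±±ₚ 0 1 (s ⊕ t) 0 1 (t ⊖ᵢ s) ⟫ ≐ ⟪ ±±ₚ 1 1 s 0 2 t ⟫) ≡.refl s t))
      (exp-≡ 0 1 1 0 0 2 1 1 (I.solve 2 (λ s t → ⟪ ±±ₚ 0 1 (s ⊕ t) 1 0 (t ⊖ᵢ s) ⟫ ≐ ⟪ ±±ₚ 0 2 s 1 1 t ⟫) ≡.refl s t)))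
      (sym (term²-mon 2 1 0 2 1 2 s 2 0 1 2 2 1 t)))
      where
      exp-≡ : ∀ x x′ y y′ u u′ v v′ →
        comboℤ (±± x x′ (s ℤ.+ t) y y′ (t ℤ.- s)) ≡ comboℤ (±± u u′ s v v′ t) →
        combo (±± x x′ (s ℤ.+ t) y y′ (t ℤ.- s)) ≡ combo (±± u u′ s v v′ t)
      exp-≡ x x′ y y′ u u′ v v′ = combo-≡ (±± x x′ (s ℤ.+ t) y y′ (t ℤ.- s)) (±± u u′ s v v′ t)

    odd-term : ∀ s t →
      termₘ 1 0 0 1 1 1 (s ℤ.+ ℤ.suc t) * termₘ 1 0 1 1 1 0 (t ℤ.- s) ≈
      a * (termₘ 4 2 1 0 0 1 s * termₘ 4 1 2 0 1 0 t)
    odd-term s t = trans (term²-mon 1 0 0 1 1 1 (s ℤ.+ ℤ.suc t) 1 0 1 1 1 0 (t ℤ.- s)) (trans (mon-≡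
      -- The entry `(1 , pos 1)` contributes △ 1 = 1, which is the extra factor `a` of the odd part.
      (exp-≡ 1 1 1 1 ((1 , pos 1) ∷ ±± 4 0 s 4 0 t) (I.solve 2 (λ s t → ⟪ ±±ₚ 1 1 (s ⊕ (con (pos 1) ⊕ t)) 1 1 (t ⊖ᵢ s) ⟫ ≐ ⟪ (1 , con (pos 1)) ∷ ±±ₚ 4 0 s 4 0 t ⟫) ≡.refl s t))
      (exp-≡ 0 1 0 1 (±± 2 0 s 1 1 t) (I.solve 2 (λ s t → ⟪ ±±ₚ 0 1 (s ⊕ (con (pos 1) ⊕ t)) 0 1 (t ⊖ᵢ s) ⟫ ≐ ⟪ ±±ₚ 2 0 s 1 1 t ⟫) ≡.refl s t))
      (exp-≡ 0 1 1 0 (±± 1 1 s 2 0 t) (I.solve 2 (λ s t → ⟪ ±±ₚ 0 1 (s ⊕ (con (pos 1) ⊕ t)) 1 0 (t ⊖ᵢ s) ⟫ ≐ ⟪ ±±ₚ 1 1 s 2 0 t ⟫) ≡.refl s t)))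
      (trans (*-assoc _ _ _) (sym (*-congˡ (term²-mon 4 2 1 0 0 1 s 4 1 2 0 1 0 t)))))
      where
      exp-≡ : ∀ x x′ y y′ ws →
        comboℤ (±± x x′ (s ℤ.+ ℤ.suc t) y y′ (t ℤ.- s)) ≡ comboℤ ws →
        combo (±± x x′ (s ℤ.+ ℤ.suc t) y y′ (t ℤ.- s)) ≡ combo ws
      exp-≡ x x′ y y′ ws = combo-≡ (±± x x′ (s ℤ.+ ℤ.suc t) y y′ (t ℤ.- s)) ws

    module _ {l : ℕ} (nilpotent : mon 2 1 1 ^ l ≈ 0#) where
      private
        b = suc l
        n = b ℕ.+ suc b

        vanishes : ∀ x y z x′ y′ z′ → mon x y z * mon x′ y′ z′ ≈ mon 2 1 1 →
                   Vanishes b (termₘ x y z x′ y′ z′)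
        vanishes x y z x′ y′ z′ eq = term-vanishes (trans (^-congˡ l eq) nilpotent)

        vanishes² : ∀ x y z x′ y′ z′ → mon x y z * mon x′ y′ z′ ≈ mon 2 1 1 * mon 2 1 1 →
                    Vanishes b (termₘ x y z x′ y′ z′)
        vanishes² x y z x′ y′ z′ eq = term-vanishes (begin
          (mon x y z * mon x′ y′ z′) ^ l        ≈⟨ ^-congˡ l eq ⟩
          (mon 2 1 1 * mon 2 1 1) ^ l           ≈⟨ ^-distrib-* _ _ l ⟩
          mon 2 1 1 ^ l * mon 2 1 1 ^ l         ≈⟨ *-congʳ nilpotent ⟩
          0# * mon 2 1 1 ^ l                    ≈⟨ zeroˡ _ ⟩
          0#                                    ∎)

        separate : ∀ f g → Vanishes b f → ∑ℤ b (λ t → ∑ℤ n (λ s → f s * g t)) ≈ ∑ℤ b f * ∑ℤ b g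
        separate f g vf = begin
          ∑ℤ b (λ t → ∑ℤ n (λ s → f s * g t))   ≈⟨ ∑ℤ-cong b (λ t _ → ∑ℤ-* (g t) n f) ⟨
          ∑ℤ b (λ t → ∑ℤ n f * g t)             ≈⟨ *-∑ℤ _ b g ⟨
          ∑ℤ n f * ∑ℤ b g                       ≈⟨ *-congʳ (∑ℤ-truncate vf (ℕ.m≤m+n b (suc b))) ⟩
          ∑ℤ b f * ∑ℤ b g                       ∎

      schröter-mon :
        𝕗 l (mon 1 0 0) (mon 1 1 1) * 𝕗 l (mon 1 0 1) (mon 1 1 0) ≈
        𝕗 l (mon 2 1 0) (mon 2 1 2) * 𝕗 l (mon 2 0 1) (mon 2 2 1) +
        a * (𝕗 l (mon 4 2 1) (mon 0 0 1) * 𝕗 l (mon 4 1 2) (mon 0 1 0))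
      schröter-mon = begin
        𝕗 l (mon 1 0 0) (mon 1 1 1) * 𝕗 l (mon 1 0 1) (mon 1 1 0)
          ≈⟨ ∑ℤ-product (vanishes 1 0 0 1 1 1 (mon-* 1 0 0 1 1 1)) (vanishes 1 0 1 1 1 0 (mon-* 1 0 1 1 1 0)) ⟩
        _
          ≈⟨ +-cong (∑ℤ-cong b (λ t _ → ∑ℤ-cong n (λ s _ → even-term s t)))
                    (∑ℤ-cong b (λ t _ → ∑ℤ-cong n (λ s _ → odd-term s t))) ⟩
        ∑ℤ b (λ t → ∑ℤ n (λ s → termₘ 2 1 0 2 1 2 s * termₘ 2 0 1 2 2 1 t)) +
        ∑ℤ b (λ t → ∑ℤ n (λ s → a * (termₘ 4 2 1 0 0 1 s * termₘ 4 1 2 0 1 0 t)))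
          ≈⟨ +-congˡ (trans (*-∑ℤ a b _) (∑ℤ-cong b (λ t _ → *-∑ℤ a n _))) ⟨
        ∑ℤ b (λ t → ∑ℤ n (λ s → termₘ 2 1 0 2 1 2 s * termₘ 2 0 1 2 2 1 t)) +
        a * ∑ℤ b (λ t → ∑ℤ n (λ s → termₘ 4 2 1 0 0 1 s * termₘ 4 1 2 0 1 0 t))
          ≈⟨ +-cong (separate _ _ (vanishes² 2 1 0 2 1 2 (trans (mon-* 2 1 0 2 1 2) (sym (mon-* 2 1 1 2 1 1)))))
                    (*-congˡ (separate _ _ (vanishes² 4 2 1 0 0 1 (trans (mon-* 4 2 1 0 0 1) (sym (mon-* 2 1 1 2 1 1)))))) ⟩
        𝕗 l (mon 2 1 0) (mon 2 1 2) * 𝕗 l (mon 2 0 1) (mon 2 2 1) +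
        a * (𝕗 l (mon 4 2 1) (mon 0 0 1) * 𝕗 l (mon 4 1 2) (mon 0 1 0)) ∎

  𝕗-comm : ∀ {l a b} → (a * b) ^ l ≈ 0# → 𝕗 l a b ≈ 𝕗 l b a
  𝕗-comm {l} {a} {b} abˡ≈0 = begin
    ∑ℤ (suc l) (term a b)            ≈⟨ ∑ℤ-neg (suc l) _ (v (pos (suc l)) ℕ.≤-refl) (v -[1+ l ] ℕ.≤-refl) ⟨
    ∑ℤ (suc l) (term a b ∘ ℤ.-_)     ≈⟨ ∑ℤ-cong (suc l) (λ z _ → trans (*-comm _ _)
                                          (*-congʳ (reflexive (cong (λ w → b ^ △ w) (ℤ.neg-involutive z))))) ⟩
    ∑ℤ (suc l) (term b a)            ∎
    where
    v : Vanishes (suc l) (term a b)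
    v = term-vanishes abˡ≈0

  -- Ramanujan's formula for f(a,b) f(c,d) when ab = cd, in the parametrization
  -- b = ahk, c = ak, d = ah, which avoids quotients of monomials.
  schröter : ∀ {l} a h k → (a * (a * (h * k))) ^ l ≈ 0# →
    𝕗 l a (a * (h * k)) * 𝕗 l (a * k) (a * h) ≈
    𝕗 l (a * a * h) (a * a * h * (k * k)) * 𝕗 l (a * a * k) (a * a * k * (h * h)) +
    a * (𝕗 l k (k * (a * a * h * (a * a * h))) * 𝕗 l h (h * (a * a * k * (a * a * k))))
  schröter {l} a h k nilpotent = trans
    (*-cong (𝕗-cong l (solve 3 (λ a h k → a := monₚ a h k 1 0 0) refl a h k)
                    (solve 3 (λ a h k → a :* (h :* k) := monₚ a h k 1 1 1) refl a h k))
            (𝕗-cong l (solve 3 (λ a h k → a :* k := monₚ a h k 1 0 1) refl a h k)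
                    (solve 3 (λ a h k → a :* h := monₚ a h k 1 1 0) refl a h k)))
    (trans (schröter-mon {l} (trans (^-congˡ l (solve 3 (λ a h k → monₚ a h k 2 1 1 := a :* (a :* (h :* k))) refl a h k)) nilpotent))
    (sym (+-cong
      (*-cong (𝕗-cong l (solve 3 (λ a h k → a :* a :* h := monₚ a h k 2 1 0) refl a h k)
                    (solve 3 (λ a h k → a :* a :* h :* (k :* k) := monₚ a h k 2 1 2) refl a h k))
              (𝕗-cong l (solve 3 (λ a h k → a :* a :* k := monₚ a h k 2 0 1) refl a h k)
                    (solve 3 (λ a h k → a :* a :* k :* (h :* h) := monₚ a h k 2 2 1) refl a h k)))
      (*-congˡ (*-cong
        -- The odd part of the change of variables produces these two series with their arguments
        -- interchanged.
        (trans (𝕗-comm (swapped k (solve 3 (λ a h k → k :* (k :* (a :* a :* h :* (a :* a :* h))) := (a :* (a :* (h :* k))) :* (a :* (a :* (h :* k)))) refl a h k)))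
               (𝕗-cong l (solve 3 (λ a h k → k :* (a :* a :* h :* (a :* a :* h)) := monₚ a h k 4 2 1) refl a h k)
                    (solve 3 (λ a h k → k := monₚ a h k 0 0 1) refl a h k)))
        (trans (𝕗-comm (swapped h (solve 3 (λ a h k → h :* (h :* (a :* a :* k :* (a :* a :* k))) := (a :* (a :* (h :* k))) :* (a :* (a :* (h :* k)))) refl a h k)))
               (𝕗-cong l (solve 3 (λ a h k → h :* (a :* a :* k :* (a :* a :* k)) := monₚ a h k 4 1 2) refl a h k)
                    (solve 3 (λ a h k → h := monₚ a h k 0 1 0) refl a h k))))))))
    where
    open Schröter a h k
    monₚ : ∀ {n} (a h k : Polynomial n) → ℕ → ℕ → ℕ → Polynomial n
    monₚ a h k x y z = (a :^ x) :* ((h :^ y) :* (k :^ z))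
    swapped : ∀ x {y} → x * y ≈ (a * (a * (h * k))) * (a * (a * (h * k))) → (x * y) ^ l ≈ 0#
    swapped x eq = trans (^-congˡ l eq) (trans (^-distrib-* _ _ l) (trans (*-congʳ nilpotent) (zeroˡ _)))

-- Jacobi's triple product

△-⊖-suc : ∀ i n → n ℕ.+ △ (i ⊖ n) ≡ △ (i ⊖ suc n) ℕ.+ i
△-⊖-suc (suc i) (suc n) rewrite ℤ.[1+m]⊖[1+n]≡m⊖n i n | ℤ.[1+m]⊖[1+n]≡m⊖n i (suc n) | ℕ.+-suc (△ (i ⊖ suc n)) i =
  cong suc (△-⊖-suc i n)
△-⊖-suc zero    zero    = ≡.refl
△-⊖-suc zero    (suc n) = ≡.sym (ℕ.+-identityʳ _)
△-⊖-suc (suc i) zero    rewrite ℤ.[1+m]⊖[1+n]≡m⊖n i 0 = ℕ.+-comm (suc i) (tri i)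

△-neg-⊖-suc : ∀ i n → suc n ℕ.+ △ (ℤ.- (i ⊖ n)) ≡ △ (ℤ.- (i ⊖ suc n)) ℕ.+ i
△-neg-⊖-suc (suc i) (suc n) rewrite ℤ.[1+m]⊖[1+n]≡m⊖n i n | ℤ.[1+m]⊖[1+n]≡m⊖n i (suc n) | ℕ.+-suc (△ (ℤ.- (i ⊖ suc n))) i =
  cong suc (△-neg-⊖-suc i n)
△-neg-⊖-suc zero          zero    = ≡.refl
△-neg-⊖-suc zero          (suc n) = ≡.sym (ℕ.+-identityʳ _)
△-neg-⊖-suc (suc zero)    zero    = ≡.refl
△-neg-⊖-suc (suc (suc i)) zero    = ≡.trans (cong suc (ℕ.+-comm (suc i) (tri i))) (≡.sym (ℕ.+-suc (tri i) (suc i)))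

⊖-swap : ∀ {i j m n} → i ℕ.+ j ≡ m ℕ.+ n → i ⊖ n ≡ ℤ.- (j ⊖ m)
⊖-swap {i} {j} {m} {n} eq = begin
  i ⊖ n                          ≡⟨ ℤ.m-n≡m⊖n i n ⟨
  pos i ℤ.- pos n                ≡⟨ solve 3 (λ i j n → i :- n := (i :+ j) :- (j :+ n)) ≡.refl (pos i) (pos j) (pos n) ⟩
  pos (i ℕ.+ j) ℤ.- pos (j ℕ.+ n)    ≡⟨ cong (λ k → pos k ℤ.- pos (j ℕ.+ n)) eq ⟩
  pos (m ℕ.+ n) ℤ.- pos (j ℕ.+ n)    ≡⟨ solve 3 (λ m j n → (m :+ n) :- (j :+ n) := :- (j :- m)) ≡.refl (pos m) (pos j) (pos n) ⟩
  ℤ.- (pos j ℤ.- pos m)          ≡⟨ cong ℤ.-_ (ℤ.m-n≡m⊖n j m) ⟩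
  ℤ.- (j ⊖ m)                    ∎
  where
  open ≡.≡-Reasoning
  open +-*-Solver

module TripleProduct {c ℓ} (R : CommutativeSemiring c ℓ) where
  open CommutativeSemiring R hiding (zero)
  open Sums R
  open Theta R
  open import Algebra.Properties.Semiring.Exp semiring
  open import Algebra.Properties.CommutativeSemiring.Exp R using (^-distrib-*)
  open import Algebra.Properties.CommutativeSemigroup *-commutativeSemigroup
    using () renaming (interchange to *-interchange; x∙yz≈y∙xz to x*yz≈y*xz)
  open import Algebra.Properties.CommutativeSemigroup +-commutativeSemigroup using (interchange; x∙yz≈y∙xz)
  open import Relation.Binary.Reasoning.Setoid setoid
  open import Algebra.Solver.Ring.NaturalCoefficients.Default R using (solve; _:=_; _:+_; _:*_; _:^_; con)

  -- Passing both indices to the summand avoids truncated subtraction. The same sum later serves as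
  -- the Cauchy product of power series.
  antidiagonal : ℕ → (ℕ → ℕ → Carrier) → Carrier
  antidiagonal zero    f = f 0 0
  antidiagonal (suc n) f = f 0 (suc n) + antidiagonal n (f ∘ suc)

  antidiagonal-cong : ∀ n {f g} → (∀ i j → i ℕ.+ j ≡ n → f i j ≈ g i j) → antidiagonal n f ≈ antidiagonal n g
  antidiagonal-cong zero    f≈g = f≈g 0 0 ≡.refl
  antidiagonal-cong (suc n) f≈g = +-cong (f≈g 0 (suc n) ≡.refl) (antidiagonal-cong n (λ i j eq → f≈g (suc i) j (cong suc eq)))

  antidiagonal-snoc : ∀ n f → antidiagonal (suc n) f ≈ antidiagonal n (λ i j → f i (suc j)) + f (suc n) 0
  antidiagonal-snoc zero    f = refl
  antidiagonal-snoc (suc n) f = trans (+-congˡ (antidiagonal-snoc n (f ∘ suc))) (sym (+-assoc _ _ _))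

  antidiagonal-+ : ∀ n f g → antidiagonal n (λ i j → f i j + g i j) ≈ antidiagonal n f + antidiagonal n g
  antidiagonal-+ zero    f g = refl
  antidiagonal-+ (suc n) f g = trans (+-congˡ (antidiagonal-+ n (f ∘ suc) (g ∘ suc))) (interchange _ _ _ _)

  *-antidiagonal : ∀ x n f → x * antidiagonal n f ≈ antidiagonal n (λ i j → x * f i j)
  *-antidiagonal x zero    f = refl
  *-antidiagonal x (suc n) f = trans (distribˡ x _ _) (+-congˡ (*-antidiagonal x n (f ∘ suc)))

  -- The shape of Pascal's rule: an interior entry receives a contribution from each of its two
  -- neighbours, an end entry from one only.
  antidiagonal-merge : ∀ n (f g h : ℕ → ℕ → Carrier) →
    (∀ j → f 0 (suc j) ≈ h 0 j) → (∀ i → f (suc i) 0 ≈ g i 0) →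
    (∀ i j → f (suc i) (suc j) ≈ g i (suc j) + h (suc i) j) →
    antidiagonal (suc n) f ≈ antidiagonal n g + antidiagonal n h
  antidiagonal-merge zero    f g h f0 f1 f2 = trans (+-cong (f0 0) (f1 0)) (+-comm _ _)
  antidiagonal-merge (suc n) f g h f0 f1 f2 = begin
    f 0 (suc (suc n)) + antidiagonal (suc n) (f ∘ suc)
      ≈⟨ +-cong (f0 (suc n)) (antidiagonal-snoc n (f ∘ suc)) ⟩
    h 0 (suc n) + (antidiagonal n (λ i j → f (suc i) (suc j)) + f (suc (suc n)) 0)
      ≈⟨ +-congˡ (+-cong (trans (antidiagonal-cong n (λ i j _ → f2 i j)) (antidiagonal-+ n _ _)) (f1 (suc n))) ⟩
    h 0 (suc n) + ((antidiagonal n (λ i j → g i (suc j)) + antidiagonal n (h ∘ suc)) + g (suc n) 0)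
      ≈⟨ solve 4 (λ w x y z → w :+ ((x :+ y) :+ z) := (x :+ z) :+ (w :+ y)) refl _ _ _ _ ⟩
    (antidiagonal n (λ i j → g i (suc j)) + g (suc n) 0) + (h 0 (suc n) + antidiagonal n (h ∘ suc))
      ≈⟨ +-congʳ (antidiagonal-snoc n g) ⟨
    antidiagonal (suc n) g + antidiagonal (suc n) h ∎

  antidiagonal-∑< : ∀ n f → antidiagonal n (λ i _ → f i) ≈ ∑< (suc n) f
  antidiagonal-∑< zero    f = sym (trans (∑<-cons 0 f) (trans (+-congˡ (∑<-empty _)) (+-identityʳ _)))
  antidiagonal-∑< (suc n) f = trans (+-congˡ (antidiagonal-∑< n (f ∘ suc))) (sym (∑<-cons (suc n) f))

  antidiagonal-⊖ : ∀ m n f → antidiagonal (n ℕ.+ m) (λ i _ → f (i ⊖ n)) ≈ ∑< (suc m) (f ∘ pos) + ∑< n (f ∘ -[1+_])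
  antidiagonal-⊖ m zero    f = trans (antidiagonal-∑< m (f ∘ pos)) (sym (trans (+-congˡ (∑<-empty _)) (+-identityʳ _)))
  antidiagonal-⊖ m (suc n) f = begin
    f -[1+ n ] + antidiagonal (n ℕ.+ m) (λ i _ → f (suc i ⊖ suc n))
      ≈⟨ +-congˡ (trans (antidiagonal-cong (n ℕ.+ m) (λ i _ _ → reflexive (cong f (ℤ.[1+m]⊖[1+n]≡m⊖n i n)))) (antidiagonal-⊖ m n f)) ⟩
    f -[1+ n ] + (∑< (suc m) (f ∘ pos) + ∑< n (f ∘ -[1+_]))
      ≈⟨ trans (x∙yz≈y∙xz _ _ _) (+-congˡ (+-comm _ _)) ⟩
    ∑< (suc m) (f ∘ pos) + (∑< n (f ∘ -[1+_]) + f -[1+ n ])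
      ≈⟨ +-congˡ (∑<-snoc n _) ⟨
    ∑< (suc m) (f ∘ pos) + ∑< (suc n) (f ∘ -[1+_]) ∎

  -- The q-binomial coefficient of i + j over i.
  gauss : Carrier → ℕ → ℕ → Carrier
  gauss q zero    j       = 1#
  gauss q (suc i) zero    = 1#
  gauss q (suc i) (suc j) = gauss q i (suc j) + q ^ suc i * gauss q (suc i) j

  gauss-zero : ∀ q i → gauss q i 0 ≈ 1#
  gauss-zero q zero    = refl
  gauss-zero q (suc i) = refl

  -- The second q-Pascal rule, with the power of q attached to the other summand. It makes up for
  -- the asymmetry of the recursion: it handles the factors in `a` of the triple product, and the
  -- limit in j.
  gauss-pascal : ∀ q i j → gauss q (suc i) (suc j) ≈ q ^ suc j * gauss q i (suc j) + gauss q (suc i) j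
  gauss-pascal q zero    zero    = solve 1 (λ q → con 1 :+ (q :^ 1) :* con 1 := (q :^ 1) :* con 1 :+ con 1) refl q
  gauss-pascal q zero    (suc j) = begin
    1# + q ^ 1 * gauss q 1 (suc j)
      ≈⟨ +-congˡ (*-congˡ (gauss-pascal q 0 j)) ⟩
    1# + q ^ 1 * (q ^ suc j * 1# + gauss q 1 j)
      ≈⟨ solve 3 (λ q x g → con 1 :+ (q :^ 1) :* (q :* x :* con 1 :+ g) := q :* (q :* x) :* con 1 :+ (con 1 :+ (q :^ 1) :* g)) refl q (q ^ j) (gauss q 1 j) ⟩
    q ^ suc (suc j) * 1# + gauss q 1 (suc j) ∎
  gauss-pascal q (suc i) zero    = begin
    gauss q (suc i) 1 + q ^ suc (suc i) * 1#
      ≈⟨ +-congʳ (gauss-pascal q i 0) ⟩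
    (q ^ 1 * gauss q i 1 + 1#) + q ^ suc (suc i) * 1#
      ≈⟨ solve 3 (λ q x g → ((q :^ 1) :* g :+ con 1) :+ q :* (q :* x) :* con 1 := (q :^ 1) :* (g :+ q :* x :* con 1) :+ con 1) refl q (q ^ i) (gauss q i 1) ⟩
    q ^ 1 * gauss q (suc i) 1 + 1# ∎
  gauss-pascal q (suc i) (suc j) = begin
    gauss q (suc i) (suc (suc j)) + q ^ suc (suc i) * gauss q (suc (suc i)) (suc j)
      ≈⟨ +-cong (gauss-pascal q i (suc j)) (*-congˡ (gauss-pascal q (suc i) j)) ⟩
    (q ^ suc (suc j) * gauss q i (suc (suc j)) + gauss q (suc i) (suc j)) +
      q ^ suc (suc i) * (q ^ suc j * gauss q (suc i) (suc j) + gauss q (suc (suc i)) j)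
      ≈⟨ solve 6 (λ q x y g h k →
           (q :* (q :* y) :* g :+ h) :+ q :* (q :* x) :* (q :* y :* h :+ k) :=
           q :* (q :* y) :* (g :+ q :* x :* h) :+ (h :+ q :* (q :* x) :* k))
         refl q (q ^ i) (q ^ j) (gauss q i (suc (suc j))) (gauss q (suc i) (suc j)) (gauss q (suc (suc i)) j) ⟩
    q ^ suc (suc j) * gauss q (suc i) (suc (suc j)) + gauss q (suc (suc i)) (suc j) ∎

  module _ {q : Carrier} {l : ℕ} (qˡ≈0 : q ^ l ≈ 0#) where
    gauss-constˡ : ∀ {i} j → l ≤ i → gauss q (suc i) j ≈ gauss q i j
    gauss-constˡ {i} zero    l≤i = sym (gauss-zero q i)
    gauss-constˡ {i} (suc j) l≤i = begin
      gauss q i (suc j) + q ^ suc i * gauss q (suc i) j   ≈⟨ +-congˡ (*-congʳ (^-vanish (ℕ.m≤n⇒m≤1+n l≤i) qˡ≈0)) ⟩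
      gauss q i (suc j) + 0# * gauss q (suc i) j          ≈⟨ trans (+-congˡ (zeroˡ _)) (+-identityʳ _) ⟩
      gauss q i (suc j)                                   ∎

    gauss-constʳ : ∀ i {j} → l ≤ j → gauss q i (suc j) ≈ gauss q i j
    gauss-constʳ zero        l≤j = refl
    gauss-constʳ (suc i) {j} l≤j = begin
      gauss q (suc i) (suc j)                             ≈⟨ gauss-pascal q i j ⟩
      q ^ suc j * gauss q i (suc j) + gauss q (suc i) j   ≈⟨ +-congʳ (*-congʳ (^-vanish (ℕ.m≤n⇒m≤1+n l≤j) qˡ≈0)) ⟩
      0# * gauss q i (suc j) + gauss q (suc i) j          ≈⟨ trans (+-congʳ (zeroˡ _)) (+-identityˡ _) ⟩
      gauss q (suc i) j                                   ∎

    -- Modulo q^l the q-binomial coefficient has already reached its limit 1/(q; q)∞.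
    gauss-const : ∀ i j → gauss q (i ℕ.+ l) (j ℕ.+ l) ≈ gauss q l l
    gauss-const zero    zero    = refl
    gauss-const zero    (suc j) = trans (gauss-constʳ l (ℕ.m≤n+m l j)) (gauss-const zero j)
    gauss-const (suc i) j       = trans (gauss-constˡ (j ℕ.+ l) (ℕ.m≤n+m l i)) (gauss-const i j)

  ∏[1+_,_] : Carrier → Carrier → ℕ → Carrier
  ∏[1+ x , q ] zero    = 1#
  ∏[1+ x , q ] (suc m) = (1# + x * q ^ m) * ∏[1+ x , q ] m

  ∏-cong : ∀ {x x′ q q′} m → x ≈ x′ → q ≈ q′ → ∏[1+ x , q ] m ≈ ∏[1+ x′ , q′ ] m
  ∏-cong zero    x≈x′ q≈q′ = refl
  ∏-cong (suc m) x≈x′ q≈q′ = *-cong (+-congˡ (*-cong x≈x′ (^-congˡ m q≈q′))) (∏-cong m x≈x′ q≈q′)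

  -- The quotient of the terms at z - 1 and z is b (ab)^(-z). For z = i - n the powers of ab are
  -- distributed over both sides so that no negative exponent appears.
  term-⊖-suc : ∀ a b i n → (b * (a * b) ^ n) * term a b (i ⊖ n) ≈ (a * b) ^ i * term a b (i ⊖ suc n)
  term-⊖-suc a b i n = begin
    (b * (a * b) ^ n) * (a ^ △ z * b ^ △ (ℤ.- z))
      ≈⟨ *-congʳ (*-congˡ (^-distrib-* a b n)) ⟩
    (b * (a ^ n * b ^ n)) * (a ^ △ z * b ^ △ (ℤ.- z))
      ≈⟨ solve 5 (λ b x y z w → (b :* (x :* y)) :* (z :* w) := (x :* z) :* ((b :* y) :* w)) refl b _ _ _ _ ⟩
    (a ^ n * a ^ △ z) * (b ^ suc n * b ^ △ (ℤ.- z))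
      ≈⟨ *-cong (^-homo-* a n _) (^-homo-* b (suc n) _) ⟨
    a ^ (n ℕ.+ △ z) * b ^ (suc n ℕ.+ △ (ℤ.- z))
      ≡⟨ cong₂ (λ x y → a ^ x * b ^ y) (△-⊖-suc i n) (△-neg-⊖-suc i n) ⟩
    a ^ (△ w ℕ.+ i) * b ^ (△ (ℤ.- w) ℕ.+ i)
      ≈⟨ *-cong (^-homo-* a (△ w) i) (^-homo-* b (△ (ℤ.- w)) i) ⟩
    (a ^ △ w * a ^ i) * (b ^ △ (ℤ.- w) * b ^ i)
      ≈⟨ *-interchange _ _ _ _ ⟩
    term a b w * (a ^ i * b ^ i)
      ≈⟨ trans (*-congˡ (sym (^-distrib-* a b i))) (*-comm _ _) ⟩
    (a * b) ^ i * term a b w ∎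
    where
    z = i ⊖ n
    w = i ⊖ suc n

  term-⊖-swap : ∀ a b {i j m n} → i ℕ.+ j ≡ m ℕ.+ n → term a b (i ⊖ n) ≈ term b a (j ⊖ m)
  term-⊖-swap a b {i} {j} {m} {n} eq rewrite ⊖-swap {i} {j} {m} {n} eq | ℤ.neg-involutive (j ⊖ m) = *-comm _ _

  term-suc-⊖ : ∀ a b {i j m n} → i ℕ.+ j ≡ m ℕ.+ n →
    (a * (a * b) ^ m) * term a b (i ⊖ n) ≈ (a * b) ^ j * term a b (suc i ⊖ n)
  term-suc-⊖ a b {i} {j} {m} {n} eq = begin
    (a * (a * b) ^ m) * term a b (i ⊖ n)      ≈⟨ *-cong (*-congˡ (^-congˡ m (*-comm a b))) (term-⊖-swap a b {i} {j} {m} {n} eq) ⟩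
    (a * (b * a) ^ m) * term b a (j ⊖ m)      ≈⟨ term-⊖-suc b a j m ⟩
    (b * a) ^ j * term b a (j ⊖ suc m)        ≈⟨ *-cong (^-congˡ j (*-comm b a)) (sym (term-⊖-swap a b {suc i} {j} {suc m} {n} (cong suc eq))) ⟩
    (a * b) ^ j * term a b (suc i ⊖ n)        ∎

  module _ (a b : Carrier) where
    private
      q = a * b

      summand : ℕ → ℕ → ℕ → Carrier
      summand n i j = term a b (i ⊖ n) * gauss q i j

      ⊖-cancel : ∀ i n → term a b (suc i ⊖ suc n) ≈ term a b (i ⊖ n)
      ⊖-cancel i n = reflexive (cong (term a b) (ℤ.[1+m]⊖[1+n]≡m⊖n i n))

      multiply-b : ∀ k n → (1# + b * q ^ n) * antidiagonal k (summand n) ≈ antidiagonal (suc k) (summand (suc n))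
      multiply-b k n = begin
        (1# + b * q ^ n) * antidiagonal k (summand n)
          ≈⟨ trans (distribʳ _ _ _) (+-cong (*-identityˡ _) (*-antidiagonal _ k _)) ⟩
        antidiagonal k (summand n) + antidiagonal k (λ i j → (b * q ^ n) * summand n i j)
          ≈⟨ antidiagonal-merge k (summand (suc n)) _ _
               (λ j → sym (trans (shift 0 j) (*-identityˡ _)))
               (λ i → *-cong (⊖-cancel i n) (sym (gauss-zero q i)))
               (λ i j → trans (distribˡ _ _ _) (+-cong (*-congʳ (⊖-cancel i n))
                 (trans (x*yz≈y*xz _ _ _) (sym (shift (suc i) j))))) ⟨
        antidiagonal (suc k) (summand (suc n)) ∎
        where
        shift : ∀ i j → (b * q ^ n) * summand n i j ≈ q ^ i * (term a b (i ⊖ suc n) * gauss q i j)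
        shift i j = trans (sym (*-assoc _ _ _)) (trans (*-congʳ (term-⊖-suc a b i n)) (*-assoc _ _ _))

      multiply-a : ∀ m n → (1# + a * q ^ m) * antidiagonal (m ℕ.+ n) (summand n) ≈ antidiagonal (suc m ℕ.+ n) (summand n)
      multiply-a m n = begin
        (1# + a * q ^ m) * antidiagonal (m ℕ.+ n) (summand n)
          ≈⟨ trans (distribʳ _ _ _) (+-cong (*-identityˡ _) (*-antidiagonal _ (m ℕ.+ n) _)) ⟩
        antidiagonal (m ℕ.+ n) (summand n) + antidiagonal (m ℕ.+ n) (λ i j → (a * q ^ m) * summand n i j)
          ≈⟨ trans (+-comm _ _) (+-congʳ (antidiagonal-cong (m ℕ.+ n) shift)) ⟩
        antidiagonal (m ℕ.+ n) (λ i j → q ^ j * (term a b (suc i ⊖ n) * gauss q i j)) + antidiagonal (m ℕ.+ n) (summand n)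
          ≈⟨ antidiagonal-merge (m ℕ.+ n) (summand n) _ _
               (λ j → refl)
               (λ i → sym (trans (*-identityˡ _) (*-congˡ (gauss-zero q i))))
               (λ i j → trans (*-congˡ (gauss-pascal q i j)) (trans (distribˡ _ _ _) (+-congʳ (x*yz≈y*xz _ _ _)))) ⟨
        antidiagonal (suc m ℕ.+ n) (summand n) ∎
        where
        shift : ∀ i j → i ℕ.+ j ≡ m ℕ.+ n → (a * q ^ m) * summand n i j ≈ q ^ j * (term a b (suc i ⊖ n) * gauss q i j)
        shift i j eq = trans (sym (*-assoc _ _ _)) (trans (*-congʳ (term-suc-⊖ a b {i} {j} {m} {n} eq)) (*-assoc _ _ _))

      -- The q-binomial theorem, recentred so that i - n runs from -n to m. A new factor in `b` uses
      -- the recursion of `gauss`, a new factor in `a` uses `gauss-pascal`.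
      finite : ∀ m n → ∏[1+ a , q ] m * ∏[1+ b , q ] n ≈ antidiagonal (m ℕ.+ n) (summand n)
      finite zero    zero    = sym (*-identityʳ _)
      finite zero    (suc n) = trans (x*yz≈y*xz _ _ _) (trans (*-congˡ (finite zero n)) (multiply-b n n))
      finite (suc m) n       = trans (*-assoc _ _ _) (trans (*-congˡ (finite m n)) (multiply-a m n))

    -- The value `gauss q l l` stands for 1/(q; q)∞, so the product is expressed through the series
    -- without a division.
    jacobi : ∀ {l m} → q ^ l ≈ 0# → l ℕ.+ suc l ≤ m →
      ∏[1+ a , q ] m * ∏[1+ b , q ] m ≈ 𝕗 l a b * gauss q l l
    jacobi {l} {m} qˡ≈0 l<m = begin
      ∏[1+ a , q ] m * ∏[1+ b , q ] m
        ≈⟨ finite m m ⟩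
      antidiagonal (m ℕ.+ m) (summand m)
        ≈⟨ antidiagonal-cong (m ℕ.+ m) limit ⟩
      antidiagonal (m ℕ.+ m) (λ i _ → gauss q l l * term a b (i ⊖ m))
        ≈⟨ *-antidiagonal _ (m ℕ.+ m) _ ⟨
      gauss q l l * antidiagonal (m ℕ.+ m) (λ i _ → term a b (i ⊖ m))
        ≈⟨ trans (*-comm _ _) (*-congʳ (antidiagonal-⊖ m m (term a b))) ⟩
      (∑< (suc m) (term a b ∘ pos) + ∑< m (term a b ∘ -[1+_])) * gauss q l l
        ≈⟨ *-congʳ (+-cong (∑<-truncate _ (s≤s l≤m) (λ i l≤i → v (pos i) l≤i))
                           (∑<-truncate _ sl≤m (λ i l≤i → v -[1+ i ] (ℕ.m≤n⇒m≤1+n l≤i)))) ⟩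
      (∑< (suc l) (term a b ∘ pos) + ∑< (suc l) (term a b ∘ -[1+_])) * gauss q l l
        ≈⟨ *-congʳ (∑ℤ-halves (suc l) _) ⟨
      𝕗 l a b * gauss q l l ∎
      where
      v : Vanishes (suc l) (term a b)
      v = term-vanishes qˡ≈0
      sl≤m : suc l ≤ m
      sl≤m = ℕ.≤-trans (ℕ.m≤n+m (suc l) l) l<m
      l≤m : l ≤ m
      l≤m = ℕ.≤-trans (ℕ.n≤1+n l) sl≤m

      far : ∀ {i j} → i ℕ.+ j ≡ m ℕ.+ m → i ≤ l → suc l ≤ ∣ i ⊖ m ∣
      far {i} {j} eq i≤l = subst (suc l ≤_) (≡.sym (ℤ.∣⊖∣-≤ (ℕ.≤-trans i≤l l≤m)))
        (ℕ.≤-trans (ℕ.≤-reflexive (≡.sym (ℕ.m+n∸m≡n l (suc l)))) (ℕ.∸-mono l<m i≤l))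

      vanish : ∀ {x y z} → x ≈ 0# → x * y ≈ z * x
      vanish x≈0 = trans (*-congʳ x≈0) (trans (zeroˡ _) (sym (trans (*-congˡ x≈0) (zeroʳ _))))

      limit : ∀ i j → i ℕ.+ j ≡ m ℕ.+ m → summand m i j ≈ gauss q l l * term a b (i ⊖ m)
      -- As m ≥ 2l + 1, an index i ≤ l or j ≤ l is at distance more than l from the centre, where
      -- the term vanishes; for all other indices the q-binomial coefficient is constant.
      limit i j eq with ℕ.≤-total i l | ℕ.≤-total j l
      ... | inj₁ i≤l | _ = vanish (v (i ⊖ m) (far eq i≤l))
      ... | inj₂ _   | inj₁ j≤l = vanish (v (i ⊖ m) (subst (suc l ≤_)
          (≡.trans (≡.sym (ℤ.∣-i∣≡∣i∣ (j ⊖ m))) (cong ∣_∣ (≡.sym (⊖-swap {i} {j} {m} {m} eq)))) (far (≡.trans (ℕ.+-comm j i) eq) j≤l)))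
      ... | inj₂ l≤i | inj₂ l≤j = trans (*-comm _ _) (*-congʳ (begin
        gauss q i j                              ≡⟨ cong₂ (gauss q) (≡.sym (ℕ.m∸n+n≡m l≤i)) (≡.sym (ℕ.m∸n+n≡m l≤j)) ⟩
        gauss q (i ℕ.∸ l ℕ.+ l) (j ℕ.∸ l ℕ.+ l)  ≈⟨ gauss-const qˡ≈0 (i ℕ.∸ l) (j ℕ.∸ l) ⟩
        gauss q l l                              ∎))

-- Weierstrass' three-term relation

-- The pair (e , n) stands for e Xⁿ.
Monomial : Set
Monomial = Sign × ℕ

infixl 7 _⊗_
_⊗_ : Monomial → Monomial → Monomial
(d , m) ⊗ (e , n) = d Sign.* e , m ℕ.+ n

⊝_ : Monomial → Monomial
⊝ (e , n) = Sign.opposite e , n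

module Weierstrass {c ℓ} (R : CommutativeRing c ℓ) (X : CommutativeRing.Carrier R) where
  open CommutativeRing R hiding (zero)
  open Sums commutativeSemiring
  open Theta commutativeSemiring
  open TripleProduct commutativeSemiring
  open import Algebra.Properties.Ring ring using (-‿distribˡ-*; -‿distribʳ-*; -‿involutive)
  open import Algebra.Properties.Semiring.Exp semiring
  open import Relation.Binary.Reasoning.Setoid setoid
  open import Algebra.Solver.Ring.NaturalCoefficients.Default commutativeSemiring
    using (solve; _:=_; _:+_; _:*_; con)

  gauss-cong : ∀ {q q′} i j → q ≈ q′ → gauss q i j ≈ gauss q′ i j
  gauss-cong zero    j       q≈q′ = refl
  gauss-cong (suc i) zero    q≈q′ = refl
  gauss-cong (suc i) (suc j) q≈q′ =
    +-cong (gauss-cong i (suc j) q≈q′) (*-cong (^-congˡ (suc i) q≈q′) (gauss-cong (suc i) j q≈q′))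

  ⟦_⟧ : Monomial → Carrier
  ⟦ Sign.+ , n ⟧ = X ^ n
  ⟦ Sign.- , n ⟧ = - (X ^ n)

  ⟦⟧-⊗ : ∀ x y → ⟦ x ⊗ y ⟧ ≈ ⟦ x ⟧ * ⟦ y ⟧
  ⟦⟧-⊗ (Sign.+ , m) (Sign.+ , n) = ^-homo-* X m n
  ⟦⟧-⊗ (Sign.+ , m) (Sign.- , n) = trans (-‿cong (^-homo-* X m n)) (-‿distribʳ-* _ _)
  ⟦⟧-⊗ (Sign.- , m) (Sign.+ , n) = trans (-‿cong (^-homo-* X m n)) (-‿distribˡ-* _ _)
  ⟦⟧-⊗ (Sign.- , m) (Sign.- , n) = begin
    X ^ (m ℕ.+ n)             ≈⟨ ^-homo-* X m n ⟩
    X ^ m * X ^ n             ≈⟨ -‿involutive _ ⟨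
    - - (X ^ m * X ^ n)       ≈⟨ -‿cong (-‿distribʳ-* _ _) ⟩
    - (X ^ m * - (X ^ n))     ≈⟨ -‿distribˡ-* _ _ ⟩
    - (X ^ m) * - (X ^ n)     ∎

  ⟦⟧-⊝ : ∀ x → ⟦ ⊝ x ⟧ + ⟦ x ⟧ ≈ 0#
  ⟦⟧-⊝ (Sign.+ , n) = -‿inverseˡ _
  ⟦⟧-⊝ (Sign.- , n) = -‿inverseʳ _

  -- Think of the coefficients as s_ij = -c_i / c_j, with s = s₁₂, t = s₂₃, u = s₃₄. Then b_i a_j +
  -- s_ij a_i b_j is c_i times a minor of the matrix with rows b_i / c_i and a_i, and necessarily
  -- s₁₃ = -st, s₂₄ = -tu, s₁₄ = stu. The signs enter through the hypotheses alone, so a solver for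
  -- commutative semirings suffices.
  plücker : ∀ {s t u s₁₃ s₂₄ s₁₄} a₁ a₂ a₃ a₄ b₁ b₂ b₃ b₄ →
    s₁₃ + s * t ≈ 0# → s₂₄ + t * u ≈ 0# → s₁₄ ≈ s * t * u → s₁₃ * s₂₄ ≈ (s * t) * (t * u) →
    (b₁ * a₄ + s₁₄ * (a₁ * b₄)) * (b₂ * a₃ + t * (a₂ * b₃)) ≈
    (b₁ * a₃ + s₁₃ * (a₁ * b₃)) * (b₂ * a₄ + s₂₄ * (a₂ * b₄)) +
    t * ((b₁ * a₂ + s * (a₁ * b₂)) * (b₃ * a₄ + u * (a₃ * b₄)))
  plücker {s} {t} {u} {s₁₃} {s₂₄} {s₁₄} a₁ a₂ a₃ a₄ b₁ b₂ b₃ b₄ eq₁₃ eq₂₄ eq₁₄ eq = sym (begin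
    (b₁ * a₃ + s₁₃ * (a₁ * b₃)) * (b₂ * a₄ + s₂₄ * (a₂ * b₄)) +
    t * ((b₁ * a₂ + s * (a₁ * b₂)) * (b₃ * a₄ + u * (a₃ * b₄)))
      ≈⟨ solve 13 (λ s t u p q a₁ a₂ a₃ a₄ b₁ b₂ b₃ b₄ →
           (b₁ :* a₃ :+ p :* (a₁ :* b₃)) :* (b₂ :* a₄ :+ q :* (a₂ :* b₄)) :+
           t :* ((b₁ :* a₂ :+ s :* (a₁ :* b₂)) :* (b₃ :* a₄ :+ u :* (a₃ :* b₄))) :=
           (q :+ t :* u) :* (b₁ :* a₂ :* a₃ :* b₄) :+ ((p :+ s :* t) :* (a₁ :* b₂ :* b₃ :* a₄) :+
           (p :* q) :* (a₁ :* a₂ :* b₃ :* b₄)) :+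
           (b₁ :* b₂ :* a₃ :* a₄ :+ t :* (b₁ :* a₂ :* b₃ :* a₄) :+ s :* t :* u :* (a₁ :* b₂ :* a₃ :* b₄)))
         refl s t u s₁₃ s₂₄ a₁ a₂ a₃ a₄ b₁ b₂ b₃ b₄ ⟩
    (s₂₄ + t * u) * _ + ((s₁₃ + s * t) * _ + (s₁₃ * s₂₄) * _) + _
      ≈⟨ +-congʳ (+-cong (trans (*-congʳ eq₂₄) (zeroˡ _)) (+-cong (trans (*-congʳ eq₁₃) (zeroˡ _)) (*-congʳ eq))) ⟩
    0# + (0# + (s * t) * (t * u) * _) + _
      ≈⟨ solve 11 (λ s t u a₁ a₂ a₃ a₄ b₁ b₂ b₃ b₄ →
           con 0 :+ (con 0 :+ (s :* t) :* (t :* u) :* (a₁ :* a₂ :* b₃ :* b₄)) :+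
           (b₁ :* b₂ :* a₃ :* a₄ :+ t :* (b₁ :* a₂ :* b₃ :* a₄) :+ s :* t :* u :* (a₁ :* b₂ :* a₃ :* b₄)) :=
           (b₁ :* a₄ :+ s :* t :* u :* (a₁ :* b₄)) :* (b₂ :* a₃ :+ t :* (a₂ :* b₃)))
         refl s t u a₁ a₂ a₃ a₄ b₁ b₂ b₃ b₄ ⟩
    (b₁ * a₄ + s * t * u * (a₁ * b₄)) * (b₂ * a₃ + t * (a₂ * b₃))
      ≈⟨ *-congʳ (+-congˡ (*-congʳ eq₁₄)) ⟨
    (b₁ * a₄ + s₁₄ * (a₁ * b₄)) * (b₂ * a₃ + t * (a₂ * b₃)) ∎)

  module ThreeTerm (N l m : ℕ) (nilpotent : (X ^ N) ^ l ≈ 0#) (l<m : l ℕ.+ suc l ≤ m) where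
    private
      q κ : Carrier
      q = X ^ N
      κ = gauss q l l

    ∏ : Monomial → Carrier
    ∏ x = ∏[1+ ⟦ x ⟧ , q ] m

    Point : Set
    Point = Monomial × Monomial

    -- As xy = q, these are f(q/x, qx) and f(x, q²/x). Both have base q², whereas the products have
    -- base q; up to monomials they are the classical θ₃ and θ₂.
    α β : Point → Carrier
    α (x , y) = 𝕗 l ⟦ y ⟧ (⟦ y ⟧ * (⟦ x ⟧ * ⟦ x ⟧))
    β (x , y) = 𝕗 l ⟦ x ⟧ (⟦ x ⟧ * (⟦ y ⟧ * ⟦ y ⟧))

    -- The points (x , y) and (x′ , y′), with x y = x′ y′ = Xᴺ and x / x′ = s².
    record Apart (s : Monomial) (P P′ : Point) : Set where
      constructor apart
      field
        eqˣ : proj₁ P ≡ s ⊗ s ⊗ proj₁ P′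
        eqʸ : proj₂ P′ ≡ s ⊗ s ⊗ proj₂ P
        eqᴺ : s ⊗ (s ⊗ (proj₁ P′ ⊗ proj₂ P)) ≡ (Sign.+ , N)
        eqᴺ′ : (s ⊗ proj₂ P) ⊗ (s ⊗ proj₁ P′) ≡ (Sign.+ , N)

    -- With x = e^(2u), x′ = e^(2v) and xy = q one has s = e^(u-v) up to sign, s x′ = e^(u+v), s x′
    -- y = q e^(v-u) and s y = q e^(-u-v). So this is θ(u - v) θ(u + v) with θ(w) = ∏ (1 + e^w q^i)
    -- (1 + e^(-w) q^(i+1)).
    quad : Monomial → Point → Point → Carrier
    quad s (x , y) (x′ , y′) = (∏ s * ∏ (s ⊗ (x′ ⊗ y))) * (∏ (s ⊗ y) * ∏ (s ⊗ x′))

    -- Two triple products followed by Ramanujan's formula with h = x′ and k = y. The resulting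
    -- series separate into one factor for each point precisely because s² x′ = x and s² y = y′.
    quad-expand : ∀ {s P P′} → Apart s P P′ → quad s P P′ ≈ (β P * α P′ + ⟦ s ⟧ * (α P * β P′)) * (κ * κ)
    quad-expand {s} {x , y} {x′ , y′} (apart eqˣ eqʸ eqᴺ _) = begin
      (∏ s * ∏ (s ⊗ (x′ ⊗ y))) * (∏ (s ⊗ y) * ∏ (s ⊗ x′))
        ≈⟨ *-cong (*-cong (∏-cong m refl q≈₁) (∏-cong m sx′y q≈₁))
                  (*-cong (∏-cong m (⟦⟧-⊗ s y) q≈₂) (∏-cong m (⟦⟧-⊗ s x′) q≈₂)) ⟩
      _ ≈⟨ *-cong (jacobi S (S * (X′ * Y)) (nil q≈₁) l<m) (jacobi (S * Y) (S * X′) (nil q≈₂) l<m) ⟩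
      _ ≈⟨ *-cong (*-congˡ (gauss-cong l l (sym q≈₁))) (*-congˡ (gauss-cong l l (sym q≈₂))) ⟩
      (𝕗 l S (S * (X′ * Y)) * κ) * (𝕗 l (S * Y) (S * X′) * κ)
        ≈⟨ solve 3 (λ f g k → (f :* k) :* (g :* k) := (f :* g) :* (k :* k)) refl _ _ _ ⟩
      (𝕗 l S (S * (X′ * Y)) * 𝕗 l (S * Y) (S * X′)) * (κ * κ)
        ≈⟨ *-congʳ (schröter S X′ Y (nil q≈₁)) ⟩
      (𝕗 l (S * S * X′) (S * S * X′ * (Y * Y)) * 𝕗 l (S * S * Y) (S * S * Y * (X′ * X′)) +
        S * (𝕗 l Y (Y * (S * S * X′ * (S * S * X′))) * 𝕗 l X′ (X′ * (S * S * Y * (S * S * Y))))) * (κ * κ)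
        ≈⟨ *-congʳ (+-cong (*-cong (𝕗-cong l ssx′ (*-congʳ ssx′)) (𝕗-cong l ssy (*-congʳ ssy)))
             (*-congˡ (*-cong (𝕗-cong l refl (*-congˡ (*-cong ssx′ ssx′))) (𝕗-cong l refl (*-congˡ (*-cong ssy ssy)))))) ⟩
      (β (x , y) * α (x′ , y′) + S * (α (x , y) * β (x′ , y′))) * (κ * κ) ∎
      where
      S X′ Y : Carrier
      S = ⟦ s ⟧
      X′ = ⟦ x′ ⟧
      Y = ⟦ y ⟧
      sx′y : ⟦ s ⊗ (x′ ⊗ y) ⟧ ≈ S * (X′ * Y)
      sx′y = trans (⟦⟧-⊗ s (x′ ⊗ y)) (*-congˡ (⟦⟧-⊗ x′ y))
      q≈₁ : q ≈ S * (S * (X′ * Y))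
      q≈₁ = trans (reflexive (cong ⟦_⟧ (≡.sym eqᴺ))) (trans (⟦⟧-⊗ s _) (*-congˡ sx′y))
      q≈₂ : q ≈ (S * Y) * (S * X′)
      q≈₂ = trans q≈₁ (solve 3 (λ s x y → s :* (s :* (x :* y)) := (s :* y) :* (s :* x)) refl S X′ Y)
      nil : ∀ {x} → q ≈ x → x ^ l ≈ 0#
      nil q≈x = trans (^-congˡ l (sym q≈x)) nilpotent
      ssx′ : S * S * X′ ≈ ⟦ x ⟧
      ssx′ = sym (trans (reflexive (cong ⟦_⟧ eqˣ)) (trans (⟦⟧-⊗ (s ⊗ s) x′) (*-congʳ (⟦⟧-⊗ s s))))
      ssy : S * S * Y ≈ ⟦ y′ ⟧
      ssy = sym (trans (reflexive (cong ⟦_⟧ eqʸ)) (trans (⟦⟧-⊗ (s ⊗ s) y) (*-congʳ (⟦⟧-⊗ s s))))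

    -- Each `quad` carries κ², so Plücker's relation is simply multiplied by κ⁴, and the constant κ
    -- is never inverted.
    weierstrass : ∀ {s t u P₁ P₂ P₃ P₄} →
      let s₁₃ = ⊝ (s ⊗ t) ; s₂₄ = ⊝ (t ⊗ u) ; s₁₄ = s ⊗ t ⊗ u in
      Apart s P₁ P₂ → Apart t P₂ P₃ → Apart u P₃ P₄ →
      Apart s₁₃ P₁ P₃ → Apart s₂₄ P₂ P₄ → Apart s₁₄ P₁ P₄ →
      s₁₃ ⊗ s₂₄ ≡ (s ⊗ t) ⊗ (t ⊗ u) →
      quad s₁₄ P₁ P₄ * quad t P₂ P₃ ≈
      quad s₁₃ P₁ P₃ * quad s₂₄ P₂ P₄ + ⟦ t ⟧ * (quad s P₁ P₂ * quad u P₃ P₄)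
    weierstrass {s} {t} {u} {P₁} {P₂} {P₃} {P₄} A₁₂ A₂₃ A₃₄ A₁₃ A₂₄ A₁₄ eq = begin
      quad (s ⊗ t ⊗ u) P₁ P₄ * quad t P₂ P₃
        ≈⟨ *-cong (quad-expand A₁₄) (quad-expand A₂₃) ⟩
      (_ * (κ * κ)) * (_ * (κ * κ))
        ≈⟨ solve 3 (λ x y k → (x :* k) :* (y :* k) := (x :* y) :* (k :* k)) refl _ _ _ ⟩
      (_ * _) * ((κ * κ) * (κ * κ))
        ≈⟨ *-congʳ (plücker (α P₁) (α P₂) (α P₃) (α P₄) (β P₁) (β P₂) (β P₃) (β P₄)
             (trans (+-congˡ (sym (⟦⟧-⊗ s t))) (⟦⟧-⊝ (s ⊗ t)))
             (trans (+-congˡ (sym (⟦⟧-⊗ t u))) (⟦⟧-⊝ (t ⊗ u)))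
             (trans (⟦⟧-⊗ (s ⊗ t) u) (*-congʳ (⟦⟧-⊗ s t)))
             (trans (sym (⟦⟧-⊗ (⊝ (s ⊗ t)) (⊝ (t ⊗ u)))) (trans (reflexive (cong ⟦_⟧ eq))
               (trans (⟦⟧-⊗ (s ⊗ t) (t ⊗ u)) (*-cong (⟦⟧-⊗ s t) (⟦⟧-⊗ t u)))))) ⟩
      (_ * _ + ⟦ t ⟧ * (_ * _)) * ((κ * κ) * (κ * κ))
        ≈⟨ solve 6 (λ x y t z w k → (x :* y :+ t :* (z :* w)) :* (k :* k) :=
             (x :* k) :* (y :* k) :+ t :* ((z :* k) :* (w :* k))) refl _ _ _ _ _ _ ⟩
      (_ * (κ * κ)) * (_ * (κ * κ)) + ⟦ t ⟧ * ((_ * (κ * κ)) * (_ * (κ * κ)))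
        ≈⟨ +-cong (*-cong (quad-expand A₁₃) (quad-expand A₂₄)) (*-congˡ (*-cong (quad-expand A₁₂) (quad-expand A₃₄))) ⟨
      quad (⊝ (s ⊗ t)) P₁ P₃ * quad (⊝ (t ⊗ u)) P₂ P₄ + ⟦ t ⟧ * (quad s P₁ P₂ * quad u P₃ P₄) ∎

-- Relations between products of theta functions

Complementary : Monomial → Monomial → Set
Complementary u v = u ⊗ v ≡ (Sign.+ , 24)

-- Write [r] for (q^r, q^(48-r); q^48)∞ and {±r} for (±q^r, ±q^(24-r); q^24)∞. Then
-- {r} = [r] [24 - r] and {r} {-r} = [2 r], so that the product of {±r} with its
-- denominator is its numerator. The factors of {r} are 1 - qⁿ, hence Sign.- stands for {r}
-- and Sign.+ for {-r}.
fold48 : ℕ → ℕ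
fold48 n = if n ℕ.≤ᵇ 24 then n else 48 ℕ.∸ n

numerator denominator : Monomial → Monomial → List ℕ
numerator (Sign.- , a) (_ , b) = a ∷ b ∷ []
numerator (Sign.+ , a) (_ , b) = fold48 (a ℕ.+ a) ∷ []
denominator (Sign.- , a) (_ , b) = []
denominator (Sign.+ , a) (_ , b) = a ∷ b ∷ []

Term : Set
Term = Monomial × List ℕ

negate : Term → Term
negate (m , rs) = ⊝ m , rs

infixr 8 _⊙_
-- Sorting gives products a normal form, so that concrete terms with the same factors agree by
-- evaluation.
_⊙_ : Term → Term → Term
(m , rs) ⊙ (m′ , rs′) = m ⊗ m′ , sort (rs ++ rs′)

module Products {c ℓ} (R : CommutativeRing c ℓ) (X : CommutativeRing.Carrier R) (M : ℕ)
  (Xᴹ≈0 : CommutativeRing._≈_ R (Exp._^_ (CommutativeRing.semiring R) X M) (CommutativeRing.0# R)) where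

  open CommutativeRing R hiding (zero) renaming (refl to ≈-refl; trans to ≈-trans; sym to ≈-sym)
  open Exp semiring
  open Theta commutativeSemiring using (^-vanish)
  open TripleProduct commutativeSemiring using (∏[1+_,_]; ∏-cong)
  open Weierstrass R X public
  open import Algebra.Properties.Ring ring using (-‿distribˡ-*)
  open import Algebra.Properties.CommutativeSemiring.Exp commutativeSemiring using (^-distrib-*)
  open import Algebra.Properties.CommutativeSemigroup *-commutativeSemigroup using (interchange)
  open import Relation.Binary.Reasoning.Setoid setoid
  open import Algebra.Solver.Ring.NaturalCoefficients.Default commutativeSemiring
    using (solve; _:=_; _:+_; _:*_; con)

  private
    -- The 2k factors of base X^24 are enough for `jacobi`, which asks for 2M + 1, and they split by
    -- parity into exactly k and k factors of base X^48.
    k = suc M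

  X^-vanish : ∀ {n} → M ≤ n → X ^ n ≈ 0#
  X^-vanish M≤n = ^-vanish M≤n Xᴹ≈0

  nilpotent : (X ^ 24) ^ M ≈ 0#
  nilpotent = ≈-trans (^-assocʳ X 24 M) (X^-vanish (ℕ.m≤n*m M 24))

  open ThreeTerm 24 M (k ℕ.+ k) nilpotent (ℕ.+-mono-≤ (ℕ.n≤1+n M) ℕ.≤-refl) renaming (∏ to ∏₂₄) public

  ∏₄₈ : ℕ → ℕ → Carrier
  ∏₄₈ n r = ∏[1+ ⟦ Sign.- , r ⟧ , X ^ 48 ] n

  ⟨_⟩ : ℕ → Carrier
  ⟨ r ⟩ = ∏₄₈ k r * ∏₄₈ k (48 ℕ.∸ r)

  ∏-even-odd : ∀ x q n → ∏[1+ x , q ] (n ℕ.+ n) ≈ ∏[1+ x , q * q ] n * ∏[1+ x * q , q * q ] n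
  ∏-even-odd x q zero    = ≈-sym (*-identityʳ _)
  ∏-even-odd x q (suc n) rewrite ℕ.+-suc n n = begin
    (1# + x * (q * q ^ (n ℕ.+ n))) * ((1# + x * q ^ (n ℕ.+ n)) * ∏[1+ x , q ] (n ℕ.+ n))
      ≈⟨ *-cong (+-congˡ (*-congˡ (*-congˡ q²ⁿ))) (*-cong (+-congˡ (*-congˡ q²ⁿ)) (∏-even-odd x q n)) ⟩
    (1# + x * (q * (q * q) ^ n)) * ((1# + x * (q * q) ^ n) * (∏[1+ x , q * q ] n * ∏[1+ x * q , q * q ] n))
      ≈⟨ solve 5 (λ x q y e o → (con 1 :+ x :* (q :* y)) :* ((con 1 :+ x :* y) :* (e :* o)) :=
           ((con 1 :+ x :* y) :* e) :* ((con 1 :+ (x :* q) :* y) :* o)) ≈-refl x q ((q * q) ^ n) _ _ ⟩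
    ∏[1+ x , q * q ] (suc n) * ∏[1+ x * q , q * q ] (suc n) ∎
    where
    q²ⁿ : q ^ (n ℕ.+ n) ≈ (q * q) ^ n
    q²ⁿ = ≈-trans (^-homo-* q n n) (≈-sym (^-distrib-* q q n))

  ∏-neg : ∀ x q n → ∏[1+ - x , q ] n * ∏[1+ x , q ] n ≈ ∏[1+ - (x * x) , q * q ] n
  ∏-neg x q zero    = *-identityʳ _
  ∏-neg x q (suc n) = begin
    ((1# + - x * q ^ n) * _) * ((1# + x * q ^ n) * _)
      ≈⟨ interchange _ _ _ _ ⟩
    ((1# + - x * q ^ n) * (1# + x * q ^ n)) * _
      ≈⟨ *-cong factor (∏-neg x q n) ⟩
    ∏[1+ - (x * x) , q * q ] (suc n) ∎
    where
    y = q ^ n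
    factor : (1# + - x * y) * (1# + x * y) ≈ 1# + - (x * x) * (q * q) ^ n
    factor = begin
      (1# + - x * y) * (1# + x * y)
        ≈⟨ solve 3 (λ x x̄ y → (con 1 :+ x̄ :* y) :* (con 1 :+ x :* y) := con 1 :+ (x̄ :+ x) :* y :+ (x̄ :* x) :* (y :* y)) ≈-refl x (- x) y ⟩
      1# + (- x + x) * y + (- x * x) * (y * y)
        ≈⟨ +-cong (≈-trans (+-congˡ (≈-trans (*-congʳ (-‿inverseˡ x)) (zeroˡ y))) (+-identityʳ 1#))
                  (*-cong (≈-sym (-‿distribˡ-* x x)) (≈-sym (^-distrib-* q q n))) ⟩
      1# + - (x * x) * (q * q) ^ n ∎

  ∏₄₈-stable : ∀ r i → ∏₄₈ (i ℕ.+ k) r ≈ ∏₄₈ k r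
  ∏₄₈-stable r zero    = ≈-refl
  ∏₄₈-stable r (suc i) = begin
    (1# + ⟦ Sign.- , r ⟧ * (X ^ 48) ^ n) * ∏₄₈ n r
      ≈⟨ *-congʳ (+-congˡ (*-congˡ (≈-trans (^-assocʳ X 48 n) (X^-vanish (ℕ.≤-trans M≤n (ℕ.m≤n*m n 48)))))) ⟩
    (1# + ⟦ Sign.- , r ⟧ * 0#) * ∏₄₈ n r
      ≈⟨ ≈-trans (*-congʳ (≈-trans (+-congˡ (zeroʳ _)) (+-identityʳ 1#))) (*-identityˡ _) ⟩
    ∏₄₈ n r
      ≈⟨ ∏₄₈-stable r i ⟩
    ∏₄₈ k r ∎
    where
    n = i ℕ.+ k
    M≤n : M ≤ n
    M≤n = ℕ.≤-trans (ℕ.n≤1+n M) (ℕ.m≤n+m k i)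

  X²⁴X²⁴≈X⁴⁸ : X ^ 24 * X ^ 24 ≈ X ^ 48
  X²⁴X²⁴≈X⁴⁸ = ≈-sym (^-homo-* X 24 24)

  ∏₂₄-minus : ∀ a → ∏₂₄ (Sign.- , a) ≈ ∏₄₈ k a * ∏₄₈ k (a ℕ.+ 24)
  ∏₂₄-minus a = ≈-trans (∏-even-odd _ _ k) (*-cong
    (∏-cong k ≈-refl X²⁴X²⁴≈X⁴⁸)
    (∏-cong k (≈-sym (⟦⟧-⊗ (Sign.- , a) (Sign.+ , 24))) X²⁴X²⁴≈X⁴⁸))

  ∏₂₄-± : ∀ a → ∏₂₄ (Sign.- , a) * ∏₂₄ (Sign.+ , a) ≈ ∏₄₈ k (a ℕ.+ a)
  ∏₂₄-± a = ≈-trans (∏-neg _ _ (k ℕ.+ k))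
    (≈-trans (∏-cong (k ℕ.+ k) (-‿cong (≈-sym (^-homo-* X a a))) X²⁴X²⁴≈X⁴⁸) (∏₄₈-stable (a ℕ.+ a) k))

  ∏₂₄-minus-pair : ∀ a b → a ℕ.+ b ≡ 24 → ∏₂₄ (Sign.- , a) * ∏₂₄ (Sign.- , b) ≈ ⟨ a ⟩ * ⟨ b ⟩
  ∏₂₄-minus-pair a b a+b≡24 = begin
    ∏₂₄ (Sign.- , a) * ∏₂₄ (Sign.- , b)
      ≈⟨ *-cong (∏₂₄-minus a) (∏₂₄-minus b) ⟩
    (∏₄₈ k a * ∏₄₈ k (a ℕ.+ 24)) * (∏₄₈ k b * ∏₄₈ k (b ℕ.+ 24))
      ≈⟨ solve 4 (λ w x y z → (w :* x) :* (y :* z) := (w :* z) :* (y :* x)) ≈-refl _ _ _ _ ⟩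
    (∏₄₈ k a * ∏₄₈ k (b ℕ.+ 24)) * (∏₄₈ k b * ∏₄₈ k (a ℕ.+ 24))
      ≡⟨ cong₂ (λ x y → (∏₄₈ k a * ∏₄₈ k x) * (∏₄₈ k b * ∏₄₈ k y)) (reflect a b a+b≡24) (reflect b a (≡.trans (ℕ.+-comm b a) a+b≡24)) ⟩
    ⟨ a ⟩ * ⟨ b ⟩ ∎
    where
    reflect : ∀ a b → a ℕ.+ b ≡ 24 → b ℕ.+ 24 ≡ 48 ℕ.∸ a
    reflect a b eq = ≡.trans (≡.sym (ℕ.m+n∸m≡n a (b ℕ.+ 24)))
      (cong (ℕ._∸ a) (≡.trans (≡.sym (ℕ.+-assoc a b 24)) (cong (ℕ._+ 24) eq)))

  ⟨⟩-reflect : ∀ {r} → r ≤ 48 → ⟨ 48 ℕ.∸ r ⟩ ≈ ⟨ r ⟩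
  ⟨⟩-reflect {r} r≤48 rewrite ℕ.m∸[m∸n]≡n r≤48 = *-comm _ _

  ⟨⟩-fold : ∀ {r} → r ≤ 48 → ⟨ fold48 r ⟩ ≈ ⟨ r ⟩
  ⟨⟩-fold {r} r≤48 with r ℕ.≤ᵇ 24
  ... | true  = ≈-refl
  ... | false = ⟨⟩-reflect r≤48

  ∏₂₄-±-pair : ∀ a b → a ℕ.+ b ≡ 24 →
    (⟨ a ⟩ * ⟨ b ⟩) * (∏₂₄ (Sign.+ , a) * ∏₂₄ (Sign.+ , b)) ≈ ⟨ fold48 (a ℕ.+ a) ⟩
  ∏₂₄-±-pair a b a+b≡24 = begin
    (⟨ a ⟩ * ⟨ b ⟩) * (∏₂₄ (Sign.+ , a) * ∏₂₄ (Sign.+ , b))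
      ≈⟨ *-congʳ (∏₂₄-minus-pair a b a+b≡24) ⟨
    (∏₂₄ (Sign.- , a) * ∏₂₄ (Sign.- , b)) * (∏₂₄ (Sign.+ , a) * ∏₂₄ (Sign.+ , b))
      ≈⟨ ≈-trans (interchange _ _ _ _) (*-cong (∏₂₄-± a) (∏₂₄-± b)) ⟩
    ∏₄₈ k (a ℕ.+ a) * ∏₄₈ k (b ℕ.+ b)
      ≡⟨ cong (λ r → ∏₄₈ k (a ℕ.+ a) * ∏₄₈ k r) (≡.trans (≡.sym (ℕ.m+n∸m≡n (a ℕ.+ a) (b ℕ.+ b))) (cong (ℕ._∸ (a ℕ.+ a)) sum)) ⟩
    ⟨ a ℕ.+ a ⟩
      ≈⟨ ⟨⟩-fold (subst (a ℕ.+ a ≤_) sum (ℕ.m≤m+n (a ℕ.+ a) (b ℕ.+ b))) ⟨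
    ⟨ fold48 (a ℕ.+ a) ⟩ ∎
    where
    open import Algebra.Properties.CommutativeSemigroup ℕ.+-commutativeSemigroup using () renaming (interchange to +-interchange)
    sum : (a ℕ.+ a) ℕ.+ (b ℕ.+ b) ≡ 48
    sum = ≡.trans (+-interchange a a b b) (cong₂ ℕ._+_ a+b≡24 a+b≡24)

  ∏ₗ : (ℕ → Carrier) → List ℕ → Carrier
  ∏ₗ f []       = 1#
  ∏ₗ f (r ∷ rs) = f r * ∏ₗ f rs

  ∏ₗ-cong : ∀ {f g} rs → (∀ r → f r ≈ g r) → ∏ₗ f rs ≈ ∏ₗ g rs
  ∏ₗ-cong []       f≈g = ≈-refl
  ∏ₗ-cong (r ∷ rs) f≈g = *-cong (f≈g r) (∏ₗ-cong rs f≈g)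

  ∏ₗ-++ : ∀ f rs rs′ → ∏ₗ f (rs ++ rs′) ≈ ∏ₗ f rs * ∏ₗ f rs′
  ∏ₗ-++ f []       rs′ = ≈-sym (*-identityˡ _)
  ∏ₗ-++ f (r ∷ rs) rs′ = ≈-trans (*-congˡ (∏ₗ-++ f rs rs′)) (≈-sym (*-assoc _ _ _))

  ∏ₗ-↭ : ∀ f {rs rs′} → rs ↭ rs′ → ∏ₗ f rs ≈ ∏ₗ f rs′
  ∏ₗ-↭ f ↭.refl         = ≈-refl
  ∏ₗ-↭ f (↭.prep r p)   = *-congˡ (∏ₗ-↭ f p)
  ∏ₗ-↭ f (↭.swap r s p) = ≈-trans (≈-sym (*-assoc _ _ _)) (≈-trans (*-cong (*-comm _ _) (∏ₗ-↭ f p)) (*-assoc _ _ _))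
  ∏ₗ-↭ f (↭.trans p p′) = ≈-trans (∏ₗ-↭ f p) (∏ₗ-↭ f p′)

  ∏ₗ-* : ∀ f g rs → ∏ₗ (λ r → f r * g r) rs ≈ ∏ₗ f rs * ∏ₗ g rs
  ∏ₗ-* f g []       = ≈-sym (*-identityˡ _)
  ∏ₗ-* f g (r ∷ rs) = ≈-trans (*-congˡ (∏ₗ-* f g rs)) (interchange _ _ _ _)

  ∏ₗ-1 : ∀ rs → ∏ₗ (λ _ → 1#) rs ≈ 1#
  ∏ₗ-1 []       = ≈-refl
  ∏ₗ-1 (r ∷ rs) = ≈-trans (*-identityˡ _) (∏ₗ-1 rs)

  ∏ₗ-filter : ∀ (S : ℕ → Bool) f rs → ∏ₗ (λ r → if S r then f r else 1#) rs ≈ ∏ₗ f (filterᵇ S rs)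
  ∏ₗ-filter S f []       = ≈-refl
  ∏ₗ-filter S f (r ∷ rs) with S r
  ... | true  = *-congˡ (∏ₗ-filter S f rs)
  ... | false = ≈-trans (*-identityˡ _) (∏ₗ-filter S f rs)

  prod : List ℕ → Carrier
  prod = ∏ₗ ⟨_⟩

  prod-++ : ∀ rs rs′ → prod (rs ++ rs′) ≈ prod rs * prod rs′
  prod-++ = ∏ₗ-++ ⟨_⟩

  prod-sort : ∀ rs → prod (sort rs) ≈ prod rs
  prod-sort rs = ∏ₗ-↭ ⟨_⟩ (sort-↭ rs)

  clear : ∀ u v → Complementary u v → prod (denominator u v) * (∏₂₄ u * ∏₂₄ v) ≈ prod (numerator u v)
  clear (Sign.- , a) (Sign.- , b) eq = ≈-trans (*-identityˡ _)
    (≈-trans (∏₂₄-minus-pair a b (cong proj₂ eq)) (*-congˡ (≈-sym (*-identityʳ _))))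
  clear (Sign.+ , a) (Sign.+ , b) eq = ≈-trans (*-congʳ (*-congˡ (*-identityʳ _)))
    (≈-trans (∏₂₄-±-pair a b (cong proj₂ eq)) (≈-sym (*-identityʳ _)))
  clear (Sign.- , a) (Sign.+ , b) ()
  clear (Sign.+ , a) (Sign.- , b) ()

  numerators denominators : Monomial → Point → Point → List ℕ
  numerators s (x , y) (x′ , y′) = numerator s (s ⊗ (x′ ⊗ y)) ++ numerator (s ⊗ y) (s ⊗ x′)
  denominators s (x , y) (x′ , y′) = denominator s (s ⊗ (x′ ⊗ y)) ++ denominator (s ⊗ y) (s ⊗ x′)

  clear-quad : ∀ {s P P′} → Apart s P P′ → prod (denominators s P P′) * quad s P P′ ≈ prod (numerators s P P′)
  clear-quad {s} {x , y} {x′ , y′} (apart _ _ eq eq′) = begin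
    prod (denominators s (x , y) (x′ , y′)) * quad s (x , y) (x′ , y′)
      ≈⟨ ≈-trans (*-congʳ (prod-++ (denominator s (s ⊗ (x′ ⊗ y))) _)) (interchange _ _ _ _) ⟩
    _ ≈⟨ *-cong (clear s (s ⊗ (x′ ⊗ y)) eq) (clear (s ⊗ y) (s ⊗ x′) eq′) ⟩
    _ ≈⟨ prod-++ (numerator s (s ⊗ (x′ ⊗ y))) _ ⟨
    prod (numerators s (x , y) (x′ , y′)) ∎

  eval : Term → Carrier
  eval (m , rs) = ⟦ m ⟧ * prod rs

  -- As parameters of a record the terms can be read off from the type, whereas they could not be
  -- recovered from their values under `eval`.
  record Holds (x y z : Term) : Set ℓ where
    constructor holds
    field vanishing : eval x + eval y + eval z ≈ 0#
  open Holds public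

  swap₁₂ : ∀ {x y z} → Holds x y z → Holds y x z
  swap₁₂ (holds h) = holds (≈-trans (+-congʳ (+-comm _ _)) h)

  swap₂₃ : ∀ {x y z} → Holds x y z → Holds x z y
  swap₂₃ (holds h) = holds (≈-trans (≈-trans (+-assoc _ _ _) (≈-trans (+-congˡ (+-comm _ _)) (≈-sym (+-assoc _ _ _)))) h)

  eval-⊙ : ∀ w x → eval (w ⊙ x) ≈ eval w * eval x
  eval-⊙ (m , rs) (m′ , rs′) =
    ≈-trans (*-cong (⟦⟧-⊗ m m′) (≈-trans (prod-sort (rs ++ rs′)) (prod-++ rs rs′))) (interchange _ _ _ _)

  eval-Holds : ∀ w x y z → eval (w ⊙ x) + eval (w ⊙ y) + eval (w ⊙ z) ≈ eval w * (eval x + eval y + eval z)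
  eval-Holds w x y z = ≈-trans (+-cong (+-cong (eval-⊙ w x) (eval-⊙ w y)) (eval-⊙ w z))
    (solve 4 (λ w x y z → w :* x :+ w :* y :+ w :* z := w :* (x :+ y :+ z)) ≈-refl _ _ _ _)

  scale : ∀ w {x y z} → Holds x y z → Holds (w ⊙ x) (w ⊙ y) (w ⊙ z)
  scale w {x} {y} {z} (holds h) = holds (≈-trans (eval-Holds w x y z) (≈-trans (*-congˡ h) (zeroʳ _)))

  eval-negate : ∀ x → eval (negate x) + eval x ≈ 0#
  eval-negate (m , rs) = ≈-trans (≈-sym (distribʳ _ _ _)) (≈-trans (*-congʳ (⟦⟧-⊝ m)) (zeroˡ _))

  chain : ∀ {a b c d e f} → Holds a d e → Holds b (negate d) f → Holds c (negate e) (negate f) → Holds a b c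
  chain {a} {b} {c} {d} {e} {f} (holds h₁) (holds h₂) (holds h₃) = holds (begin
    eval a + eval b + eval c
      ≈⟨ ≈-trans (+-congˡ (≈-trans (+-cong (+-cong (eval-negate d) (eval-negate e)) (eval-negate f))
           (≈-trans (+-congʳ (+-identityʳ _)) (+-identityʳ _)))) (+-identityʳ _) ⟨
    (eval a + eval b + eval c) + ((eval (negate d) + eval d) + (eval (negate e) + eval e) + (eval (negate f) + eval f))
      ≈⟨ solve 9 (λ a b c d e f d′ e′ f′ → (a :+ b :+ c) :+ ((d′ :+ d) :+ (e′ :+ e) :+ (f′ :+ f)) :=
           (a :+ d :+ e) :+ (b :+ d′ :+ f) :+ (c :+ e′ :+ f′)) ≈-refl _ _ _ _ _ _ _ _ _ ⟩
    (eval a + eval d + eval e) + (eval b + eval (negate d) + eval f) + (eval c + eval (negate e) + eval (negate f))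
      ≈⟨ ≈-trans (+-cong (+-cong h₁ h₂) h₃) (≈-trans (+-congʳ (+-identityʳ _)) (+-identityʳ _)) ⟩
    0# ∎)

  -- Weierstrass' relation is multiplied by all six denominators. Those belonging to the quads of a
  -- term turn them into numerators, and the term keeps the denominators of the other two terms.
  relation : ∀ s t u P₁ P₂ P₃ P₄ →
    let s₁₃ = ⊝ (s ⊗ t) ; s₂₄ = ⊝ (t ⊗ u) ; s₁₄ = s ⊗ t ⊗ u
        d₁₂ = denominators s P₁ P₂ ; d₂₃ = denominators t P₂ P₃ ; d₃₄ = denominators u P₃ P₄
        d₁₃ = denominators s₁₃ P₁ P₃ ; d₂₄ = denominators s₂₄ P₂ P₄ ; d₁₄ = denominators s₁₄ P₁ P₄
        n₁₂ = numerators s P₁ P₂ ; n₂₃ = numerators t P₂ P₃ ; n₃₄ = numerators u P₃ P₄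
        n₁₃ = numerators s₁₃ P₁ P₃ ; n₂₄ = numerators s₂₄ P₂ P₄ ; n₁₄ = numerators s₁₄ P₁ P₄
    in
    Apart s P₁ P₂ → Apart t P₂ P₃ → Apart u P₃ P₄ →
    Apart s₁₃ P₁ P₃ → Apart s₂₄ P₂ P₄ → Apart s₁₄ P₁ P₄ →
    s₁₃ ⊗ s₂₄ ≡ (s ⊗ t) ⊗ (t ⊗ u) →
    Holds ((Sign.+ , 0) , ((d₁₃ ++ d₂₄) ++ (d₁₂ ++ d₃₄)) ++ (n₁₄ ++ n₂₃))
          ((Sign.- , 0) , ((d₁₄ ++ d₂₃) ++ (d₁₂ ++ d₃₄)) ++ (n₁₃ ++ n₂₄))
          (⊝ t , ((d₁₄ ++ d₂₃) ++ (d₁₃ ++ d₂₄)) ++ (n₁₂ ++ n₃₄))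
  relation s t u P₁ P₂ P₃ P₄ A₁₂ A₂₃ A₃₄ A₁₃ A₂₄ A₁₄ eq = holds (begin
    ⟦ Sign.+ , 0 ⟧ * prod (((d₁₃ ++ d₂₄) ++ (d₁₂ ++ d₃₄)) ++ (n₁₄ ++ n₂₃)) +
    ⟦ Sign.- , 0 ⟧ * prod (((d₁₄ ++ d₂₃) ++ (d₁₂ ++ d₃₄)) ++ (n₁₃ ++ n₂₄)) +
    ⟦ ⊝ t ⟧ * prod (((d₁₄ ++ d₂₃) ++ (d₁₃ ++ d₂₄)) ++ (n₁₂ ++ n₃₄))
      ≈⟨ +-cong (+-cong (*-congˡ (expand d₁₃ d₂₄ d₁₂ d₃₄ A₁₄ A₂₃)) (*-congˡ (expand d₁₄ d₂₃ d₁₂ d₃₄ A₁₃ A₂₄)))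
                (*-congˡ (expand d₁₄ d₂₃ d₁₃ d₂₄ A₁₂ A₃₄)) ⟩
    1# * (((prod d₁₃ * prod d₂₄) * (prod d₁₂ * prod d₃₄)) * ((prod d₁₄ * T₁₄) * (prod d₂₃ * T₂₃))) +
    ⟦ Sign.- , 0 ⟧ * (((prod d₁₄ * prod d₂₃) * (prod d₁₂ * prod d₃₄)) * ((prod d₁₃ * T₁₃) * (prod d₂₄ * T₂₄))) +
    ⟦ ⊝ t ⟧ * (((prod d₁₄ * prod d₂₃) * (prod d₁₃ * prod d₂₄)) * ((prod d₁₂ * T₁₂) * (prod d₃₄ * T₃₄)))
      ≈⟨ solve 14 (λ d₁₂ d₂₃ d₃₄ d₁₃ d₂₄ d₁₄ T₁₂ T₃₄ T₁₃ T₂₄ T₁₄ T₂₃ ν τ →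
           con 1 :* (((d₁₃ :* d₂₄) :* (d₁₂ :* d₃₄)) :* ((d₁₄ :* T₁₄) :* (d₂₃ :* T₂₃))) :+
           ν :* (((d₁₄ :* d₂₃) :* (d₁₂ :* d₃₄)) :* ((d₁₃ :* T₁₃) :* (d₂₄ :* T₂₄))) :+
           τ :* (((d₁₄ :* d₂₃) :* (d₁₃ :* d₂₄)) :* ((d₁₂ :* T₁₂) :* (d₃₄ :* T₃₄))) :=
           ((d₁₂ :* d₃₄) :* (d₁₃ :* d₂₄) :* (d₁₄ :* d₂₃)) :* (T₁₄ :* T₂₃ :+ ν :* (T₁₃ :* T₂₄) :+ τ :* (T₁₂ :* T₃₄)))
         ≈-refl (prod d₁₂) (prod d₂₃) (prod d₃₄) (prod d₁₃) (prod d₂₄) (prod d₁₄) T₁₂ T₃₄ T₁₃ T₂₄ T₁₄ T₂₃ ⟦ Sign.- , 0 ⟧ ⟦ ⊝ t ⟧ ⟩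
    _ * (T₁₄ * T₂₃ + ⟦ Sign.- , 0 ⟧ * (T₁₃ * T₂₄) + ⟦ ⊝ t ⟧ * (T₁₂ * T₃₄))
      ≈⟨ *-congˡ (+-congʳ (+-congʳ (weierstrass A₁₂ A₂₃ A₃₄ A₁₃ A₂₄ A₁₄ eq))) ⟩
    _ * ((T₁₃ * T₂₄ + ⟦ t ⟧ * (T₁₂ * T₃₄)) + ⟦ Sign.- , 0 ⟧ * (T₁₃ * T₂₄) + ⟦ ⊝ t ⟧ * (T₁₂ * T₃₄))
      ≈⟨ *-congˡ (solve 5 (λ x y ν t τ → (x :+ t :* y) :+ ν :* x :+ τ :* y := (ν :+ con 1) :* x :+ (τ :+ t) :* y) ≈-refl _ _ _ _ _) ⟩
    _ * ((⟦ Sign.- , 0 ⟧ + 1#) * (T₁₃ * T₂₄) + (⟦ ⊝ t ⟧ + ⟦ t ⟧) * (T₁₂ * T₃₄))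
      ≈⟨ *-congˡ (+-cong (≈-trans (*-congʳ (⟦⟧-⊝ (Sign.+ , 0))) (zeroˡ _))
                         (≈-trans (*-congʳ (⟦⟧-⊝ t)) (zeroˡ _))) ⟩
    _ * (0# + 0#)
      ≈⟨ ≈-trans (*-congˡ (+-identityʳ 0#)) (zeroʳ _) ⟩
    0# ∎)
    where
    s₁₃ = ⊝ (s ⊗ t) ; s₂₄ = ⊝ (t ⊗ u) ; s₁₄ = s ⊗ t ⊗ u
    d₁₂ = denominators s P₁ P₂ ; d₂₃ = denominators t P₂ P₃ ; d₃₄ = denominators u P₃ P₄
    d₁₃ = denominators s₁₃ P₁ P₃ ; d₂₄ = denominators s₂₄ P₂ P₄ ; d₁₄ = denominators s₁₄ P₁ P₄
    n₁₂ = numerators s P₁ P₂ ; n₂₃ = numerators t P₂ P₃ ; n₃₄ = numerators u P₃ P₄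
    n₁₃ = numerators s₁₃ P₁ P₃ ; n₂₄ = numerators s₂₄ P₂ P₄ ; n₁₄ = numerators s₁₄ P₁ P₄
    T₁₂ = quad s P₁ P₂ ; T₂₃ = quad t P₂ P₃ ; T₃₄ = quad u P₃ P₄
    T₁₃ = quad s₁₃ P₁ P₃ ; T₂₄ = quad s₂₄ P₂ P₄ ; T₁₄ = quad s₁₄ P₁ P₄
    expand : ∀ d d′ d″ d‴ {s P P′ s′ Q Q′} → Apart s P P′ → Apart s′ Q Q′ →
      prod (((d ++ d′) ++ (d″ ++ d‴)) ++ (numerators s P P′ ++ numerators s′ Q Q′)) ≈
      ((prod d * prod d′) * (prod d″ * prod d‴)) *
        ((prod (denominators s P P′) * quad s P P′) * (prod (denominators s′ Q Q′) * quad s′ Q Q′))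
    expand d d′ d″ d‴ {s} {P} {P′} A A′ = ≈-trans (prod-++ ((d ++ d′) ++ (d″ ++ d‴)) _) (*-cong
      (≈-trans (prod-++ (d ++ d′) _) (*-cong (prod-++ d d′) (prod-++ d″ d‴)))
      (≈-trans (prod-++ (numerators s P P′) _) (*-cong (≈-sym (clear-quad A)) (≈-sym (clear-quad A′)))))

  -- From y = w y follows y = w^M y by iteration, and w^M = 0; no inverse of 1 - w has to be
  -- constructed.
  cancel-1-w : ∀ w {y} → w ^ M ≈ 0# → (1# + - w) * y ≈ 0# → y ≈ 0#
  cancel-1-w w {y} wᴹ≈0 eq = begin
    y               ≈⟨ iterate M ⟩
    w ^ M * y       ≈⟨ ≈-trans (*-congʳ wᴹ≈0) (zeroˡ y) ⟩
    0#              ∎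
    where
    y≈wy : y ≈ w * y
    y≈wy = begin
      y                             ≈⟨ +-identityʳ y ⟨
      y + 0#                        ≈⟨ +-congˡ (≈-trans (*-congʳ (-‿inverseˡ w)) (zeroˡ y)) ⟨
      y + (- w + w) * y             ≈⟨ solve 3 (λ w w̄ y → y :+ (w̄ :+ w) :* y := (con 1 :+ w̄) :* y :+ w :* y) ≈-refl w (- w) y ⟩
      (1# + - w) * y + w * y        ≈⟨ +-congʳ eq ⟩
      0# + w * y                    ≈⟨ +-identityˡ _ ⟩
      w * y                         ∎
    iterate : ∀ n → y ≈ w ^ n * y
    iterate zero    = ≈-sym (*-identityˡ y)
    iterate (suc n) = begin
      y                   ≈⟨ y≈wy ⟩
      w * y               ≈⟨ *-congˡ (iterate n) ⟩
      w * (w ^ n * y)     ≈⟨ *-assoc _ _ _ ⟨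
      w ^ suc n * y       ∎

  cancel-∏₄₈ : ∀ n r {y} → 1 ≤ r → ∏₄₈ n r * y ≈ 0# → y ≈ 0#
  cancel-∏₄₈ zero    r 1≤r eq = ≈-trans (≈-sym (*-identityˡ _)) eq
  cancel-∏₄₈ (suc n) r {y} 1≤r eq = cancel-∏₄₈ n r 1≤r (cancel-1-w (X ^ r * (X ^ 48) ^ n) vanish
    (≈-trans (≈-trans (*-congʳ (+-congˡ (-‿distribˡ-* _ _))) (≈-sym (*-assoc _ _ _))) eq))
    where
    vanish : (X ^ r * (X ^ 48) ^ n) ^ M ≈ 0#
    vanish = begin
      (X ^ r * (X ^ 48) ^ n) ^ M            ≈⟨ ^-distrib-* _ _ M ⟩
      (X ^ r) ^ M * ((X ^ 48) ^ n) ^ M      ≈⟨ *-congʳ (^-assocʳ X r M) ⟩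
      X ^ (r ℕ.* M) * ((X ^ 48) ^ n) ^ M    ≈⟨ *-congʳ (X^-vanish (ℕ.m≤n*m M r {{ℕ.>-nonZero 1≤r}})) ⟩
      0# * ((X ^ 48) ^ n) ^ M               ≈⟨ zeroˡ _ ⟩
      0# ∎

  cancel-prod : ∀ rs {y} → All (λ r → 1 ≤ r × 1 ≤ 48 ℕ.∸ r) rs → prod rs * y ≈ 0# → y ≈ 0#
  cancel-prod []       _              eq = ≈-trans (≈-sym (*-identityˡ _)) eq
  cancel-prod (r ∷ rs) ((p , p′) ∷ ps) eq = cancel-prod rs ps (cancel-∏₄₈ k _ p′ (cancel-∏₄₈ k r p
    (≈-trans (≈-trans (≈-sym (*-assoc _ _ _)) (≈-sym (*-assoc _ _ _))) eq)))

  cancel : ∀ rs {x y z} {_ : True (All.all? (λ r → (1 ℕ.≤? r) ×-dec (1 ℕ.≤? 48 ℕ.∸ r)) rs)} →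
    Holds (((Sign.+ , 0) , rs) ⊙ x) (((Sign.+ , 0) , rs) ⊙ y) (((Sign.+ , 0) , rs) ⊙ z) → Holds x y z
  cancel rs {x} {y} {z} {inRange} (holds h) = holds (cancel-prod rs (toWitness inRange)
    (≈-trans (*-congʳ (≈-sym (*-identityˡ _))) (≈-trans (≈-sym (eval-Holds ((Sign.+ , 0) , rs) x y z)) h)))

-- rs lists the residues of S modulo 48 up to sign.
record Residues (S : ℕ → Bool) (rs : List ℕ) : Set where
  field
    periodic : ∀ i j → S (i ℕ.+ j ℕ.* 48) ≡ S i
    complete : sort (filterᵇ S (downFrom 48)) ≡ sort (rs ++ map (48 ℕ.∸_) rs)

-- Euler products and generating functions

module GeneratingFunctions {c ℓ} (R : CommutativeRing c ℓ) (X : CommutativeRing.Carrier R) (M : ℕ)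
  (Xᴹ≈0 : CommutativeRing._≈_ R (Exp._^_ (CommutativeRing.semiring R) X M) (CommutativeRing.0# R)) where

  open CommutativeRing R hiding (zero) renaming (refl to ≈-refl; trans to ≈-trans; sym to ≈-sym)
  open Exp semiring
  open Products R X M Xᴹ≈0
  open import Algebra.Properties.Ring ring using (-‿distribˡ-*)
  open import Algebra.Properties.CommutativeSemigroup *-commutativeSemigroup using (interchange)
  open import Relation.Binary.Reasoning.Setoid setoid
  open import Algebra.Solver.Ring.NaturalCoefficients.Default commutativeSemiring
    using (solve; _:=_; _:+_; _:*_; con)

  prod-∏ₗ : ∀ rs → prod rs ≈ ∏ₗ (∏₄₈ (suc M)) (rs ++ map (48 ℕ.∸_) rs)
  prod-∏ₗ rs = ≈-trans (go rs) (≈-sym (∏ₗ-++ _ rs _))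
    where
    go : ∀ rs → prod rs ≈ ∏ₗ (∏₄₈ (suc M)) rs * ∏ₗ (∏₄₈ (suc M)) (map (48 ℕ.∸_) rs)
    go []       = ≈-sym (*-identityˡ _)
    go (r ∷ rs) = ≈-trans (*-congˡ (go rs)) (interchange _ _ _ _)

  module _ (S : ℕ → Bool) where
    factor : ℕ → Carrier
    factor n = if S n then 1# + ⟦ Sign.- , n ⟧ else 1#

    euler : ℕ → Carrier
    euler n = ∏ₗ factor (downFrom n)

    module _ {rs : List ℕ} (residues : Residues S rs) where
      open Residues residues

      private
        euler-+ : ∀ i n → euler (i ℕ.+ n) ≈ ∏ₗ (λ r → factor (r ℕ.+ n)) (downFrom i) * euler n
        euler-+ zero    n = ≈-sym (*-identityˡ _)
        euler-+ (suc i) n = ≈-trans (*-congˡ (euler-+ i n)) (≈-sym (*-assoc _ _ _))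

        factor-residue : ∀ j r → factor (r ℕ.+ j ℕ.* 48) ≈ (if S r then 1# + ⟦ Sign.- , r ⟧ * (X ^ 48) ^ j else 1#)
        factor-residue j r rewrite periodic r j with S r
        ... | false = ≈-refl
        ... | true  = +-congˡ (begin
          - (X ^ (r ℕ.+ j ℕ.* 48))        ≈⟨ -‿cong (≈-trans (^-homo-* X r (j ℕ.* 48)) (*-congˡ (≈-trans
                                               (reflexive (cong (X ^_) (ℕ.*-comm j 48))) (≈-sym (^-assocʳ X 48 j))))) ⟩
          - (X ^ r * (X ^ 48) ^ j)        ≈⟨ -‿distribˡ-* _ _ ⟩
          - (X ^ r) * (X ^ 48) ^ j        ∎)

        list : List ℕ
        list = rs ++ map (48 ℕ.∸_) rs

        filter-↭ : ∀ f → ∏ₗ f (filterᵇ S (downFrom 48)) ≈ ∏ₗ f list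
        filter-↭ f = ≈-trans (≈-sym (∏ₗ-↭ f (sort-↭ (filterᵇ S (downFrom 48))))) (≈-trans (reflexive (cong (∏ₗ f) complete)) (∏ₗ-↭ f (sort-↭ list)))

      -- One period of length 48 at a time: the period from 48 j on contributes the factor of index
      -- j to the product of each residue.
      euler-∏ₗ : ∀ j → euler (j ℕ.* 48) ≈ ∏ₗ (∏₄₈ j) list
      euler-∏ₗ zero    = ≈-sym (∏ₗ-1 list)
      euler-∏ₗ (suc j) = begin
        euler (48 ℕ.+ j ℕ.* 48)
          ≈⟨ euler-+ 48 (j ℕ.* 48) ⟩
        ∏ₗ (λ r → factor (r ℕ.+ j ℕ.* 48)) (downFrom 48) * euler (j ℕ.* 48)
          ≈⟨ *-cong (≈-trans (∏ₗ-cong (downFrom 48) (factor-residue j)) (≈-trans (∏ₗ-filter S _ (downFrom 48)) (filter-↭ _)))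
                    (euler-∏ₗ j) ⟩
        ∏ₗ (λ r → 1# + ⟦ Sign.- , r ⟧ * (X ^ 48) ^ j) list * ∏ₗ (∏₄₈ j) list
          ≈⟨ ∏ₗ-* _ _ list ⟨
        ∏ₗ (∏₄₈ (suc j)) list ∎

      euler≈prod : euler (suc M ℕ.* 48) ≈ prod rs
      euler≈prod = ≈-trans (euler-∏ₗ (suc M)) (≈-sym (prod-∏ₗ rs))

    module _ (S0 : S 0 ≡ false) (G : ℕ → Carrier) (G0 : G 0 ≈ 1#)
             (Gsuc : ∀ n → G (suc n) ≈ G n + (if S (suc n) then X ^ suc n * G (suc n) else 0#)) where

      -- For n + 1 in S the recurrence says (1 - X^(n+1)) G (n + 1) = G n, so the product
      -- telescopes. The offset arises because `euler (suc n)` ends with the factor of index n.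
      euler-inverse : ∀ n → euler (suc n) * G n ≈ 1#
      euler-inverse zero rewrite S0 = ≈-trans (*-cong (*-identityˡ 1#) G0) (*-identityˡ 1#)
      euler-inverse (suc n) with S (suc n) | Gsuc n
      ... | false | G≈ = ≈-trans (*-cong (*-identityˡ _) (≈-trans G≈ (+-identityʳ _))) (euler-inverse n)
      ... | true  | G≈ = begin
        ((1# + - (X ^ suc n)) * euler (suc n)) * G (suc n)
          ≈⟨ solve 3 (λ u e g → (u :* e) :* g := e :* (u :* g)) ≈-refl _ _ _ ⟩
        euler (suc n) * ((1# + - (X ^ suc n)) * G (suc n))
          ≈⟨ *-congˡ (≈-trans (distribʳ _ _ _) (+-cong (≈-trans (*-identityˡ _) G≈) (≈-sym (-‿distribˡ-* _ _)))) ⟩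
        euler (suc n) * ((G n + X ^ suc n * G (suc n)) + - (X ^ suc n * G (suc n)))
          ≈⟨ *-congˡ (≈-trans (+-assoc _ _ _) (≈-trans (+-congˡ (-‿inverseʳ _)) (+-identityʳ _))) ⟩
        euler (suc n) * G n
          ≈⟨ euler-inverse n ⟩
        1# ∎

  -- Division by the products over both S and T gives 1/S = X^a/T + X^c. The monomial X^c is the
  -- single exceptional coefficient: n = 6 in the second statement, n = 0 in the others.
  ShiftedIdentity : List ℕ → List ℕ → ℕ → ℕ → Set ℓ
  ShiftedIdentity S T a c = Holds ((Sign.+ , 0) , T) ((Sign.- , a) , S) ((Sign.- , c) , sort (S ++ T))

  shifted : ∀ {S T a c g h} → ShiftedIdentity S T a c → prod S * g ≈ 1# → prod T * h ≈ 1# →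
            g ≈ X ^ a * h + X ^ c
  shifted {S} {T} {a} {c} {g} {h} (holds eq) Sg≈1 Th≈1 = begin
    g
      ≈⟨ ≈-trans (≈-sym (+-identityʳ g)) (+-congˡ (≈-sym (+-identityʳ 0#))) ⟩
    g + (0# + 0#)
      ≈⟨ +-congˡ (+-cong (-‿inverseˡ _) (-‿inverseˡ _)) ⟨
    g + ((- (X ^ a * h) + X ^ a * h) + (- (X ^ c) + X ^ c))
      ≈⟨ solve 5 (λ g x x̄ y ȳ → g :+ ((x̄ :+ x) :+ (ȳ :+ y)) := (g :+ x̄ :+ ȳ) :+ (x :+ y)) ≈-refl g _ _ _ _ ⟩
    (g + - (X ^ a * h) + - (X ^ c)) + (X ^ a * h + X ^ c)
      ≈⟨ +-congʳ (begin
           g + - (X ^ a * h) + - (X ^ c)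
             ≈⟨ +-cong (+-cong (≈-trans (≈-sym (*-identityˡ g)) (*-congʳ (≈-sym Th≈1)))
                  (≈-trans (-‿distribˡ-* _ _) (*-congˡ (≈-trans (≈-sym (*-identityˡ h)) (*-congʳ (≈-sym Sg≈1))))))
                  (≈-trans (≈-sym (*-identityʳ _)) (*-congˡ (≈-trans (≈-sym (*-identityˡ 1#)) (*-cong (≈-sym Sg≈1) (≈-sym Th≈1))))) ⟩
           (prod T * h) * g + - (X ^ a) * ((prod S * g) * h) + - (X ^ c) * ((prod S * g) * (prod T * h))
             ≈⟨ solve 6 (λ s t g h x y → (t :* h) :* g :+ x :* ((s :* g) :* h) :+ y :* ((s :* g) :* (t :* h)) :=
                  (con 1 :* t :+ x :* s :+ y :* (s :* t)) :* (g :* h)) ≈-refl (prod S) (prod T) g h _ _ ⟩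
           (1# * prod T + - (X ^ a) * prod S + - (X ^ c) * (prod S * prod T)) * (g * h)
             ≈⟨ *-congʳ (≈-trans (+-congˡ (*-congˡ (≈-sym (≈-trans (prod-sort (S ++ T)) (prod-++ S T))))) eq) ⟩
           0# * (g * h)
             ≈⟨ zeroˡ _ ⟩
           0# ∎) ⟩
    0# + (X ^ a * h + X ^ c)
      ≈⟨ +-identityˡ _ ⟩
    X ^ a * h + X ^ c ∎

-- The four theta function identities

open import Data.Nat using (_+_; _*_; _∸_)
open import Data.Nat.Properties using (_≟_; _≤?_)
open ≡ using (refl; sym; trans)

S₁ T₁ : List ℕ
S₁ = 1 ∷ 5 ∷ 6 ∷ 8 ∷ 9 ∷ 10 ∷ 11 ∷ 13 ∷ 15 ∷ 19 ∷ 20 ∷ 23 ∷ []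
T₁ = 1 ∷ 4 ∷ 5 ∷ 7 ∷ 9 ∷ 10 ∷ 15 ∷ 17 ∷ 18 ∷ 19 ∷ 20 ∷ 23 ∷ []

S₂ T₂ : List ℕ
S₂ = 1 ∷ 2 ∷ 3 ∷ 4 ∷ 5 ∷ 6 ∷ 11 ∷ 13 ∷ 19 ∷ 20 ∷ 21 ∷ 23 ∷ []
T₂ = 1 ∷ 2 ∷ 3 ∷ 4 ∷ 5 ∷ 7 ∷ 8 ∷ 17 ∷ 18 ∷ 19 ∷ 21 ∷ 23 ∷ []

S₃ T₃ : List ℕ
S₃ = 4 ∷ 5 ∷ 6 ∷ 7 ∷ 8 ∷ 9 ∷ 11 ∷ 13 ∷ 15 ∷ 17 ∷ 19 ∷ 22 ∷ []
T₃ = 1 ∷ 4 ∷ 7 ∷ 9 ∷ 11 ∷ 13 ∷ 15 ∷ 17 ∷ 18 ∷ 20 ∷ 22 ∷ 23 ∷ []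

S₄ T₄ : List ℕ
S₄ = 3 ∷ 4 ∷ 5 ∷ 6 ∷ 7 ∷ 11 ∷ 13 ∷ 14 ∷ 17 ∷ 19 ∷ 20 ∷ 21 ∷ []
T₄ = 1 ∷ 3 ∷ 7 ∷ 8 ∷ 11 ∷ 13 ∷ 14 ∷ 17 ∷ 18 ∷ 20 ∷ 21 ∷ 23 ∷ []

module Identities {c ℓ} (R : CommutativeRing c ℓ) (X : CommutativeRing.Carrier R) (M : ℕ)
  (Xᴹ≈0 : CommutativeRing._≈_ R (Exp._^_ (CommutativeRing.semiring R) X M) (CommutativeRing.0# R)) where

  open Products R X M Xᴹ≈0
  open GeneratingFunctions R X M Xᴹ≈0

  point : Sign → ℕ → Point
  point δ n = (δ , n) , (δ , 24 ℕ.∸ n)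

  pattern close = apart refl refl refl refl

  -- All four proofs have the same form. The outer `scale` restores the factors common to S and T.
  -- What remains of T and of S forms `x` and the second term, and the third term is the product
  -- over the union. The list given to `cancel` is the surplus that clearing denominators and
  -- matching the three relations leave in every term.
  identity₁ : ShiftedIdentity S₁ T₁ 1 0
  identity₁ = scale ((Sign.+ , 0) , (1 ∷ 5 ∷ 9 ∷ 10 ∷ 15 ∷ 19 ∷ 20 ∷ 23 ∷ [])) (cancel (3 ∷ 6 ∷ 7 ∷ 7 ∷ 10 ∷ 10 ∷ 14 ∷ 14 ∷ 16 ∷ 17 ∷ 17 ∷ 18 ∷ 20 ∷ 21 ∷ [])
    {x = (Sign.+ , 0) , (4 ∷ 7 ∷ 17 ∷ 18 ∷ [])} {(Sign.- , 1) , (6 ∷ 8 ∷ 11 ∷ 13 ∷ [])}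
    {(Sign.- , 0) , (1 ∷ 4 ∷ 5 ∷ 6 ∷ 7 ∷ 8 ∷ 9 ∷ 10 ∷ 11 ∷ 13 ∷ 15 ∷ 17 ∷ 18 ∷ 19 ∷ 20 ∷ 23 ∷ [])} (chain
    -- Each relation is scaled until the auxiliary terms that it shares with the other two agree up
    -- to sign; the swaps put its terms in the order expected by `chain`.
    (scale ((Sign.+ , 0) , (6 ∷ 7 ∷ 17 ∷ 18 ∷ [])) (swap₂₃ (relation (Sign.- , 1) (Sign.- , 4) (Sign.- , 2)
        (point Sign.- 22) (point Sign.- 20) (point Sign.- 12) (point Sign.- 8)
        close close close close close close refl)))
    (scale ((Sign.- , 1) , (6 ∷ 7 ∷ 7 ∷ 8 ∷ 10 ∷ 14 ∷ 16 ∷ 17 ∷ 17 ∷ 20 ∷ [])) (swap₂₃ (relation (Sign.- , 2) (Sign.- , 3) (Sign.- , 1)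
        (point Sign.+ 20) (point Sign.+ 16) (point Sign.+ 10) (point Sign.+ 8)
        close close close close close close refl)))
    (scale ((Sign.- , 0) , (5 ∷ 9 ∷ 10 ∷ 15 ∷ 19 ∷ 20 ∷ [])) (relation (Sign.+ , 6) (Sign.- , 1) (Sign.+ , 3)
        (point Sign.+ 24) (point Sign.+ 12) (point Sign.+ 10) (point Sign.+ 4)
        close close close close close close refl))))

  identity₂ : ShiftedIdentity S₂ T₂ 0 6
  identity₂ = scale ((Sign.+ , 0) , (1 ∷ 2 ∷ 3 ∷ 4 ∷ 5 ∷ 19 ∷ 21 ∷ 23 ∷ [])) (cancel (1 ∷ 5 ∷ 9 ∷ 9 ∷ 10 ∷ 10 ∷ 14 ∷ 14 ∷ 15 ∷ 15 ∷ 16 ∷ 19 ∷ 22 ∷ 23 ∷ [])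
    {x = (Sign.+ , 0) , (7 ∷ 8 ∷ 17 ∷ 18 ∷ [])} {(Sign.- , 0) , (6 ∷ 11 ∷ 13 ∷ 20 ∷ [])}
    {(Sign.- , 6) , (1 ∷ 2 ∷ 3 ∷ 4 ∷ 5 ∷ 6 ∷ 7 ∷ 8 ∷ 11 ∷ 13 ∷ 17 ∷ 18 ∷ 19 ∷ 20 ∷ 21 ∷ 23 ∷ [])} (chain
    (scale ((Sign.- , 0) , (1 ∷ 5 ∷ 8 ∷ 9 ∷ 15 ∷ 16 ∷ 18 ∷ 19 ∷ 22 ∷ 23 ∷ [])) (swap₁₂ (relation (Sign.- , 4) (Sign.- , 6) (Sign.- , 1)
        (point Sign.+ 24) (point Sign.+ 16) (point Sign.+ 4) (point Sign.+ 2)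
        close close close close close close refl)))
    (scale ((Sign.- , 0) , (6 ∷ 11 ∷ 13 ∷ 22 ∷ [])) (relation (Sign.- , 1) (Sign.+ , 8) (Sign.+ , 1)
        (point Sign.+ 24) (point Sign.+ 22) (point Sign.+ 6) (point Sign.+ 4)
        close close close close close close refl))
    (scale ((Sign.+ , 6) , (1 ∷ 1 ∷ 9 ∷ 15 ∷ 23 ∷ 23 ∷ [])) (swap₁₂ (relation (Sign.+ , 3) (Sign.+ , 2) (Sign.+ , 4)
        (point Sign.+ 22) (point Sign.+ 16) (point Sign.+ 12) (point Sign.+ 4)
        close close close close close close refl)))))

  identity₃ : ShiftedIdentity S₃ T₃ 4 0
  identity₃ = scale ((Sign.+ , 0) , (4 ∷ 7 ∷ 9 ∷ 11 ∷ 13 ∷ 15 ∷ 17 ∷ 22 ∷ [])) (cancel (2 ∷ 3 ∷ 3 ∷ 7 ∷ 10 ∷ 10 ∷ 11 ∷ 13 ∷ 14 ∷ 14 ∷ 16 ∷ 17 ∷ 21 ∷ 21 ∷ [])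
    {x = (Sign.+ , 0) , (1 ∷ 18 ∷ 20 ∷ 23 ∷ [])} {(Sign.- , 4) , (5 ∷ 6 ∷ 8 ∷ 19 ∷ [])}
    {(Sign.- , 0) , (1 ∷ 4 ∷ 5 ∷ 6 ∷ 7 ∷ 8 ∷ 9 ∷ 11 ∷ 13 ∷ 15 ∷ 17 ∷ 18 ∷ 19 ∷ 20 ∷ 22 ∷ 23 ∷ [])} (chain
    (scale ((Sign.- , 0) , (1 ∷ 2 ∷ 18 ∷ 23 ∷ [])) (swap₂₃ (swap₁₂ (relation (Sign.+ , 3) (Sign.+ , 7) (Sign.- , 1)
        (point Sign.+ 24) (point Sign.+ 18) (point Sign.+ 4) (point Sign.+ 2)
        close close close close close close refl))))
    (scale ((Sign.- , 4) , (2 ∷ 3 ∷ 6 ∷ 7 ∷ 8 ∷ 11 ∷ 13 ∷ 16 ∷ 17 ∷ 21 ∷ [])) (swap₂₃ (relation (Sign.- , 1) (Sign.- , 3) (Sign.- , 6)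
        (point Sign.+ 24) (point Sign.+ 22) (point Sign.+ 16) (point Sign.+ 4)
        close close close close close close refl)))
    (scale ((Sign.+ , 0) , (3 ∷ 11 ∷ 11 ∷ 13 ∷ 13 ∷ 21 ∷ [])) (swap₁₂ (relation (Sign.+ , 1) (Sign.+ , 4) (Sign.+ , 2)
        (point Sign.+ 22) (point Sign.+ 20) (point Sign.+ 12) (point Sign.+ 8)
        close close close close close close refl)))))

  identity₄ : ShiftedIdentity S₄ T₄ 3 0
  identity₄ = scale ((Sign.+ , 0) , (3 ∷ 7 ∷ 11 ∷ 13 ∷ 14 ∷ 17 ∷ 20 ∷ 21 ∷ [])) (cancel (5 ∷ 5 ∷ 6 ∷ 9 ∷ 10 ∷ 10 ∷ 14 ∷ 14 ∷ 15 ∷ 16 ∷ 18 ∷ 19 ∷ 19 ∷ 20 ∷ [])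
    {x = (Sign.+ , 0) , (1 ∷ 8 ∷ 18 ∷ 23 ∷ [])} {(Sign.- , 3) , (4 ∷ 5 ∷ 6 ∷ 19 ∷ [])}
    {(Sign.- , 0) , (1 ∷ 3 ∷ 4 ∷ 5 ∷ 6 ∷ 7 ∷ 8 ∷ 11 ∷ 13 ∷ 14 ∷ 17 ∷ 18 ∷ 19 ∷ 20 ∷ 21 ∷ 23 ∷ [])} (chain
    (scale ((Sign.+ , 0) , (5 ∷ 5 ∷ 8 ∷ 10 ∷ 14 ∷ 16 ∷ 18 ∷ 19 ∷ 19 ∷ 20 ∷ [])) (swap₂₃ (relation (Sign.- , 2) (Sign.- , 1) (Sign.- , 3)
        (point Sign.+ 20) (point Sign.+ 16) (point Sign.+ 14) (point Sign.+ 8)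
        close close close close close close refl)))
    (scale ((Sign.- , 1) , (5 ∷ 6 ∷ 18 ∷ 19 ∷ [])) (swap₁₂ (swap₂₃ (relation (Sign.+ , 3) (Sign.- , 2) (Sign.- , 4)
        (point Sign.- 22) (point Sign.- 16) (point Sign.- 12) (point Sign.- 4)
        close close close close close close refl))))
    (scale ((Sign.- , 0) , (3 ∷ 7 ∷ 14 ∷ 17 ∷ 20 ∷ 21 ∷ [])) (relation (Sign.+ , 5) (Sign.- , 1) (Sign.+ , 4)
        (point Sign.+ 24) (point Sign.+ 14) (point Sign.+ 12) (point Sign.+ 4)
        close close close close close close refl))))

-- Partitions

pmSet-+48 : ∀ rs n → pmSet 48 rs (suc n + 48) ≡ pmSet 48 rs (suc n)
pmSet-+48 rs n = cong or (map-cong (λ r → cong₂ _∨_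
  (cong (λ k → ⌊ k ≟ r % 48 ⌋) ([m+n]%n≡m%n (suc n) 48))
  (cong (λ k → ⌊ k ≟ 0 ⌋) (trans (cong (_% 48) (trans (ℕ.+-assoc (suc n) 48 r) (trans (cong (λ k → suc n + k) (ℕ.+-comm 48 r)) (sym (ℕ.+-assoc (suc n) r 48)))))
    ([m+n]%n≡m%n (suc n + r) 48)))) rs)

-- At 0 periodicity is not automatic: `pmSet` excludes 0 by fiat but tests the positive multiples of
-- 48 by congruence. The hypothesis on 48 reconciles the two.
pmSet-periodic : ∀ rs → pmSet 48 rs 48 ≡ false → ∀ i j → pmSet 48 rs (i + j * 48) ≡ pmSet 48 rs i
pmSet-periodic rs 48∉S i       zero    = cong (pmSet 48 rs) (ℕ.+-identityʳ i)
pmSet-periodic rs 48∉S (suc i) (suc j) = trans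
  (cong (pmSet 48 rs) (trans (cong (λ k → suc i + k) (ℕ.+-comm 48 (j * 48))) (sym (ℕ.+-assoc (suc i) (j * 48) 48))))
  (trans (pmSet-+48 rs (i + j * 48)) (pmSet-periodic rs 48∉S (suc i) j))
pmSet-periodic rs 48∉S zero    (suc zero)    = 48∉S
pmSet-periodic rs 48∉S zero    (suc (suc j)) = trans
  (cong (pmSet 48 rs) (ℕ.+-comm 48 (suc j * 48)))
  (trans (pmSet-+48 rs (47 + j * 48)) (pmSet-periodic rs 48∉S zero (suc j)))

residues : ∀ {rs} → pmSet 48 rs 48 ≡ false → _ → Residues (pmSet 48 rs) rs
residues {rs} 48∉S complete = record { periodic = pmSet-periodic rs 48∉S ; complete = complete }

module _ (S : PartSet) (k : ℕ) where
  private
    q = suc k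

    ≤?-+ : ∀ x d → ⌊ q + x ≤? q + d ⌋ ≡ ⌊ x ≤? d ⌋
    ≤?-+ x d = trans (isYes≗does (q + x ≤? q + d)) (trans (does-⇔ (mk⇔ (ℕ.+-cancelˡ-≤ q x d) (ℕ.+-monoʳ-≤ q)) (q + x ≤? q + d) (x ≤? d))
      (sym (isYes≗does (x ≤? d))))

    summand : ∀ x d → (if ⌊ q + x ≤? q + d ⌋ then pb S k (q + d ∸ (q + x)) else 0) ≡ (if ⌊ x ≤? d ⌋ then pb S k (d ∸ x) else 0)
    summand x d = cong₂ (λ b n → if b then pb S k n else 0) (≤?-+ x d) (ℕ.[m+n]∸[m+o]≡n∸o q d x)

    absent : ∀ {x n} → n < x → ⌊ x ≤? n ⌋ ≡ false
    absent {x} {n} n<x = trans (isYes≗does (x ≤? n)) (dec-false (x ≤? n) (ℕ.<⇒≱ n<x))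

  sumMult-below : ∀ {n} m → n < q → sumMult S k n m ≡ pb S k n
  sumMult-below         zero    n<q = refl
  sumMult-below {n} (suc m) n<q
    rewrite absent {suc m * q} {n} (ℕ.≤-trans n<q (ℕ.m≤m+n q (m * q))) =
    trans (ℕ.+-identityʳ _) (sumMult-below m n<q)

  sumMult-suc : ∀ d m → sumMult S k (q + d) (suc m) ≡ pb S k (q + d) + sumMult S k d m
  sumMult-suc d zero    = cong (pb S k (q + d) +_) (summand 0 d)
  sumMult-suc d (suc m) = trans (cong₂ _+_ (sumMult-suc d m) (summand (suc m * q) d)) (ℕ.+-assoc (pb S k (q + d)) _ _)

  sumMult-stable : ∀ d i → sumMult S k d (i + d) ≡ sumMult S k d d
  sumMult-stable d zero    = refl
  sumMult-stable d (suc i)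
    rewrite absent {suc (i + d) * q} {d} (ℕ.≤-trans (s≤s (ℕ.m≤n+m d i)) (ℕ.m≤m*n (suc (i + d)) q)) =
    trans (ℕ.+-identityʳ _) (sumMult-stable d i)

  -- Either the part q = k + 1 is absent or one copy of it is removed. After the removal the bound
  -- on the multiplicity is k + d instead of d, but multiplicities above d contribute nothing.
  sumMult-rec : ∀ d → sumMult S k (q + d) (q + d) ≡ pb S k (q + d) + sumMult S k d d
  sumMult-rec d = trans (sumMult-suc d (k + d)) (cong (pb S k (q + d) +_) (sumMult-stable d k))

pb-stable : ∀ S n i → pb S (i + n) n ≡ p S n
pb-stable S n zero    = refl
pb-stable S n (suc i) with S (suc (i + n))
... | false = pb-stable S n i
... | true  = trans (sumMult-below S (i + n) n (s≤s (ℕ.m≤n+m n i))) (pb-stable S n i)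

-- Power series

Series : Set
Series = ℕ → ℤ

open TripleProduct ℤ.+-*-commutativeSemiring
  using (antidiagonal; antidiagonal-cong; antidiagonal-snoc; antidiagonal-+; *-antidiagonal)

infixl 7 _⋆_
_⋆_ : Series → Series → Series
(f ⋆ g) n = antidiagonal n (λ i j → f i ℤ.* g j)

one : Series
one zero    = pos 1
one (suc n) = pos 0

variable-X : Series
variable-X zero    = pos 0
variable-X (suc n) = one n

antidiagonal-flip : ∀ n F → antidiagonal n F ≡ antidiagonal n (λ i j → F j i)
antidiagonal-flip zero    F = refl
antidiagonal-flip (suc n) F = trans (cong (ℤ._+_ (F 0 (suc n))) (antidiagonal-flip n (F ∘ suc)))
  (trans (ℤ.+-comm (F 0 (suc n)) _) (sym (antidiagonal-snoc n (λ i j → F j i))))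

⋆-comm : ∀ f g n → (f ⋆ g) n ≡ (g ⋆ f) n
⋆-comm f g n = trans (antidiagonal-flip n _) (antidiagonal-cong n (λ i j _ → ℤ.*-comm (f j) (g i)))

⋆-distribʳ : ∀ h f g n → ((λ i → f i ℤ.+ g i) ⋆ h) n ≡ (f ⋆ h) n ℤ.+ (g ⋆ h) n
⋆-distribʳ h f g n = trans (antidiagonal-cong n (λ i j _ → ℤ.*-distribʳ-+ (h j) (f i) (g i))) (antidiagonal-+ n _ _)

⋆-scale : ∀ c f g n → ((λ i → c ℤ.* f i) ⋆ g) n ≡ c ℤ.* (f ⋆ g) n
⋆-scale c f g n = trans (antidiagonal-cong n (λ i j _ → ℤ.*-assoc c (f i) (g j))) (sym (*-antidiagonal c n _))

-- Induction on n after splitting off the constant term of f: by evaluation, the coefficient of f ⋆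
-- g at i + 1 is f 0 g (i + 1) plus that of (f ∘ suc) ⋆ g at i.
⋆-assoc : ∀ f g h n → ((f ⋆ g) ⋆ h) n ≡ (f ⋆ (g ⋆ h)) n
⋆-assoc f g h zero    = ℤ.*-assoc (f 0) (g 0) (h 0)
⋆-assoc f g h (suc n) = begin
  f 0 ℤ.* g 0 ℤ.* h (suc n) ℤ.+ ((λ i → f 0 ℤ.* g (suc i) ℤ.+ (f ∘ suc ⋆ g) i) ⋆ h) n
    ≡⟨ cong (ℤ._+_ (f 0 ℤ.* g 0 ℤ.* h (suc n))) (⋆-distribʳ h (λ i → f 0 ℤ.* g (suc i)) (f ∘ suc ⋆ g) n) ⟩
  f 0 ℤ.* g 0 ℤ.* h (suc n) ℤ.+ (((λ i → f 0 ℤ.* g (suc i)) ⋆ h) n ℤ.+ ((f ∘ suc ⋆ g) ⋆ h) n)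
    ≡⟨ cong₂ (λ x y → f 0 ℤ.* g 0 ℤ.* h (suc n) ℤ.+ (x ℤ.+ y)) (⋆-scale (f 0) (g ∘ suc) h n) (⋆-assoc (f ∘ suc) g h n) ⟩
  f 0 ℤ.* g 0 ℤ.* h (suc n) ℤ.+ (f 0 ℤ.* (g ∘ suc ⋆ h) n ℤ.+ (f ∘ suc ⋆ (g ⋆ h)) n)
    ≡⟨ ℤ.+-assoc (f 0 ℤ.* g 0 ℤ.* h (suc n)) _ _ ⟨
  f 0 ℤ.* g 0 ℤ.* h (suc n) ℤ.+ f 0 ℤ.* (g ∘ suc ⋆ h) n ℤ.+ (f ∘ suc ⋆ (g ⋆ h)) n
    ≡⟨ cong (ℤ._+ (f ∘ suc ⋆ (g ⋆ h)) n) (trans (cong (ℤ._+ f 0 ℤ.* (g ∘ suc ⋆ h) n) (ℤ.*-assoc (f 0) (g 0) (h (suc n))))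
         (sym (ℤ.*-distribˡ-+ (f 0) (g 0 ℤ.* h (suc n)) _))) ⟩
  f 0 ℤ.* (g ⋆ h) (suc n) ℤ.+ (f ∘ suc ⋆ (g ⋆ h)) n ∎
  where open ≡.≡-Reasoning

⋆-zeroˡ : ∀ g n → ((λ _ → pos 0) ⋆ g) n ≡ pos 0
⋆-zeroˡ g zero    = refl
⋆-zeroˡ g (suc n) = trans (ℤ.+-identityˡ _) (⋆-zeroˡ g n)

⋆-identityˡ : ∀ g n → (one ⋆ g) n ≡ g n
⋆-identityˡ g zero    = ℤ.*-identityˡ (g 0)
⋆-identityˡ g (suc n) = trans (cong₂ ℤ._+_ (ℤ.*-identityˡ (g (suc n))) (⋆-zeroˡ g n)) (ℤ.+-identityʳ (g (suc n)))

X⋆ : ∀ f n → (variable-X ⋆ f) (suc n) ≡ f n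
X⋆ f n = trans (ℤ.+-identityˡ _) (⋆-identityˡ f n)

record _≈[_]_ (f : Series) (M : ℕ) (g : Series) : Set where
  constructor agree
  field coefficient : ∀ n → n < M → f n ≡ g n
open _≈[_]_

-- ℤ[[X]] modulo Xᴹ: the truncation is in the equality, not in the carrier.
truncated : ℕ → CommutativeRing 0ℓ 0ℓ
truncated M = record
  { Carrier = Series
  ; _≈_ = _≈[ M ]_
  ; _+_ = λ f g n → f n ℤ.+ g n
  ; _*_ = _⋆_
  ; -_ = λ f n → ℤ.- f n
  ; 0# = λ _ → pos 0
  ; 1# = one
  ; isCommutativeRing = record
    { isRing = record
      { +-isAbelianGroup = record
        { isGroup = record
          { isMonoid = record
            { isSemigroup = record
              { isMagma = record
                { isEquivalence = record
                  { refl = agree (λ _ _ → refl)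
                  ; sym = λ (agree p) → agree (λ n n<M → sym (p n n<M))
                  ; trans = λ (agree p) (agree q) → agree (λ n n<M → trans (p n n<M) (q n n<M))
                  }
                ; ∙-cong = λ (agree p) (agree q) → agree (λ n n<M → cong₂ ℤ._+_ (p n n<M) (q n n<M))
                }
              ; assoc = λ f g h → agree (λ n _ → ℤ.+-assoc (f n) (g n) (h n))
              }
            ; identity = (λ f → agree (λ n _ → ℤ.+-identityˡ (f n))) , (λ f → agree (λ n _ → ℤ.+-identityʳ (f n)))
            }
          ; inverse = (λ f → agree (λ n _ → ℤ.+-inverseˡ (f n))) , (λ f → agree (λ n _ → ℤ.+-inverseʳ (f n)))
          ; ⁻¹-cong = λ (agree p) → agree (λ n n<M → cong ℤ.-_ (p n n<M))
          }
        ; comm = λ f g → agree (λ n _ → ℤ.+-comm (f n) (g n))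
        }
      ; *-cong = λ (agree p) (agree q) → agree (λ n n<M → antidiagonal-cong n (λ i j i+j≡n → cong₂ ℤ._*_
          (p i (ℕ.≤-<-trans (ℕ.m+n≤o⇒m≤o i (ℕ.≤-reflexive i+j≡n)) n<M))
          (q j (ℕ.≤-<-trans (ℕ.m+n≤o⇒n≤o i (ℕ.≤-reflexive i+j≡n)) n<M))))
      ; *-assoc = λ f g h → agree (λ n _ → ⋆-assoc f g h n)
      ; *-identity = (λ f → agree (λ n _ → ⋆-identityˡ f n)) , (λ f → agree (λ n _ → trans (⋆-comm f one n) (⋆-identityˡ f n)))
      ; distrib = (λ h f g → agree (λ n _ → trans (⋆-comm h _ n) (trans (⋆-distribʳ h f g n) (cong₂ ℤ._+_ (⋆-comm f h n) (⋆-comm g h n)))))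
                , (λ h f g → agree (λ n _ → ⋆-distribʳ h f g n))
      }
    ; *-comm = λ f g → agree (λ n _ → ⋆-comm f g n)
    }
  }

module _ (M : ℕ) where
  open Exp (CommutativeRing.semiring (truncated M)) using (_^_)

  X^-≢ : ∀ c {n} → n ≢ c → (variable-X ^ c) n ≡ pos 0
  X^-≢ zero    {zero}  n≢c = contradiction refl n≢c
  X^-≢ zero    {suc n} n≢c = refl
  X^-≢ (suc c) {zero}  n≢c = refl
  X^-≢ (suc c) {suc n} n≢c = trans (X⋆ _ n) (X^-≢ c (n≢c ∘ cong suc))

  X^-shift : ∀ a f n → ((variable-X ^ a) ⋆ f) (a + n) ≡ f n
  X^-shift zero    f n = ⋆-identityˡ f n
  X^-shift (suc a) f n = trans (⋆-assoc variable-X (variable-X ^ a) f (suc a + n)) (trans (X⋆ _ (a + n)) (X^-shift a f n))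

  X^-below : ∀ a f {n} → n < a → ((variable-X ^ a) ⋆ f) n ≡ pos 0
  X^-below (suc a) f {zero}  n<a       = refl
  X^-below (suc a) f {suc n} (s≤s n<a) = trans (⋆-assoc variable-X (variable-X ^ a) f (suc n)) (trans (X⋆ _ n) (X^-below a f n<a))

  Xᴹ≈0 : (variable-X ^ M) ≈[ M ] (λ _ → pos 0)
  Xᴹ≈0 = agree (λ n n<M → X^-≢ M (ℕ.<⇒≢ n<M))

  open CommutativeRing (truncated M) using (0#) renaming (_+_ to _⊕_; _*_ to _⊛_; trans to ≈-trans; *-congʳ to ⊛-congʳ; sym to ≈-sym)
  open GeneratingFunctions (truncated M) variable-X M Xᴹ≈0
  open Products (truncated M) variable-X M Xᴹ≈0 using (prod)

  module _ (S : PartSet) where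
    gf : ℕ → Series
    gf k n = pos (pb S k n)

    gf-zero : gf 0 ≈[ M ] one
    gf-zero = agree λ { zero _ → refl ; (suc n) _ → refl }

    -- Below k + 1 the shifted series has zero coefficients and the part cannot occur; from k + 1 on
    -- this is `sumMult-rec`.
    gf-suc : ∀ k → gf (suc k) ≈[ M ] (gf k ⊕ (if S (suc k) then (variable-X ^ suc k) ⊛ gf (suc k) else 0#))
    gf-suc k = agree (λ n _ → go n)
      where
      go : ∀ n → gf (suc k) n ≡ (gf k ⊕ (if S (suc k) then (variable-X ^ suc k) ⊛ gf (suc k) else 0#)) n
      go n with S (suc k)
      ... | false = sym (ℤ.+-identityʳ (gf k n))
      ... | true with suc k ℕ.≤? n
      ...   | no  k≮n = trans (cong pos (sumMult-below S k n (ℕ.≰⇒> k≮n)))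
              (sym (trans (cong (ℤ._+_ (gf k n)) (X^-below (suc k) (λ m → pos (sumMult S k m m)) (ℕ.≰⇒> k≮n))) (ℤ.+-identityʳ (gf k n))))
      ...   | yes k<n = subst (λ m → pos (sumMult S k m m) ≡ gf k m ℤ.+ ((variable-X ^ suc k) ⋆ (λ m → pos (sumMult S k m m))) m)
              (ℕ.m+[n∸m]≡n k<n)
              (trans (cong pos (sumMult-rec S k d)) (cong (ℤ._+_ (gf k (suc k + d))) (sym (X^-shift (suc k) (λ m → pos (sumMult S k m m)) d))))
        where d = n ∸ suc k

    -- The bound 47 + 48 M on the parts is one less than 48 (M + 1), so the Euler product it calls
    -- for covers exactly M + 1 full periods.
    gf-inverse : ∀ {rs} → Residues S rs → S 0 ≡ false → (prod rs ⊛ gf (47 + M * 48)) ≈[ M ] one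
    gf-inverse {rs} residues S0 = ≈-trans (⊛-congʳ (≈-sym (euler≈prod S residues)))
      (euler-inverse S S0 gf gf-zero gf-suc (47 + M * 48))

    gf-coefficient : ∀ {n} → n ≤ M → gf (47 + M * 48) n ≡ pos (p S n)
    gf-coefficient {n} n≤M = cong pos (trans (cong (λ k → pb S k n) (sym (ℕ.m∸n+n≡m n≤K))) (pb-stable S n (47 + M * 48 ∸ n)))
      where
      n≤K : n ≤ 47 + M * 48
      n≤K = ℕ.≤-trans n≤M (ℕ.≤-trans (ℕ.m≤m*n M 48) (ℕ.m≤n+m (M * 48) 47))

-- From the identities to partition numbers

shifted-partitions : ∀ {rs rs′ a c} →
  Residues (pmSet 48 rs) rs → Residues (pmSet 48 rs′) rs′ →
  (∀ M → GeneratingFunctions.ShiftedIdentity (truncated M) variable-X M (Xᴹ≈0 M) rs rs′ a c) →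
  ∀ n → a + n ≢ c → p (pmSet 48 rs) (a + n) ≡ p (pmSet 48 rs′) n
shifted-partitions {rs} {rs′} {a} {c} resS resT identity n a+n≢c = ℤ.+-injective (begin
  pos (p S (a + n))
    ≡⟨ gf-coefficient M S (ℕ.n≤1+n (a + n)) ⟨
  gf M S K (a + n)
    ≡⟨ coefficient (GeneratingFunctions.shifted (truncated M) variable-X M (Xᴹ≈0 M) (identity M)
         (gf-inverse M S resS refl) (gf-inverse M T resT refl)) (a + n) ℕ.≤-refl ⟩
  ((variable-X ^ a) ⋆ gf M T K) (a + n) ℤ.+ (variable-X ^ c) (a + n)
    ≡⟨ cong₂ ℤ._+_ (X^-shift M a (gf M T K) n) (X^-≢ M c a+n≢c) ⟩
  gf M T K n ℤ.+ pos 0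
    ≡⟨ ℤ.+-identityʳ (gf M T K n) ⟩
  gf M T K n
    ≡⟨ gf-coefficient M T (ℕ.m≤n⇒m≤1+n (ℕ.m≤n+m n a)) ⟩
  pos (p T n) ∎)
  where
  S = pmSet 48 rs
  T = pmSet 48 rs′
  -- The coefficient of index a + n is the last one that survives the truncation.
  M = suc (a + n)
  K = 47 + M * 48
  open ≡.≡-Reasoning
  open Exp (CommutativeRing.semiring (truncated M)) using (_^_)

shifted-partitions-∸ : ∀ {rs rs′ a} →
  Residues (pmSet 48 rs) rs → Residues (pmSet 48 rs′) rs′ →
  (∀ M → GeneratingFunctions.ShiftedIdentity (truncated M) variable-X M (Xᴹ≈0 M) rs rs′ (suc a) 0) →
  ∀ n → suc a ≤ n → p (pmSet 48 rs) n ≡ p (pmSet 48 rs′) (n ∸ suc a)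
shifted-partitions-∸ {rs} {rs′} {a} resS resT identity n a<n =
  trans (cong (p (pmSet 48 rs)) (sym (ℕ.m+[n∸m]≡n a<n)))
        -- The exceptional index is 0, which a positive shift never reaches.
        (shifted-partitions resS resT identity (n ∸ suc a) (λ ()))

theorem7p5 :
    ((n : ℕ) → 1 ≤ n →
      p (pmSet 48 (1 ∷ 5 ∷ 6 ∷ 8 ∷ 9 ∷ 10 ∷ 11 ∷ 13 ∷ 15 ∷ 19 ∷ 20 ∷ 23 ∷ [])) (n)
        ≡ p (pmSet 48 (1 ∷ 4 ∷ 5 ∷ 7 ∷ 9 ∷ 10 ∷ 15 ∷ 17 ∷ 18 ∷ 19 ∷ 20 ∷ 23 ∷ [])) (n ∸ 1))
    × ((n : ℕ) → n ≢ 6 →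
      p (pmSet 48 (1 ∷ 2 ∷ 3 ∷ 4 ∷ 5 ∷ 6 ∷ 11 ∷ 13 ∷ 19 ∷ 20 ∷ 21 ∷ 23 ∷ [])) n
        ≡ p (pmSet 48 (1 ∷ 2 ∷ 3 ∷ 4 ∷ 5 ∷ 7 ∷ 8 ∷ 17 ∷ 18 ∷ 19 ∷ 21 ∷ 23 ∷ [])) n)
    × ((n : ℕ) → 4 ≤ n →
      p (pmSet 48 (4 ∷ 5 ∷ 6 ∷ 7 ∷ 8 ∷ 9 ∷ 11 ∷ 13 ∷ 15 ∷ 17 ∷ 19 ∷ 22 ∷ [])) n
        ≡ p (pmSet 48 (1 ∷ 4 ∷ 7 ∷ 9 ∷ 11 ∷ 13 ∷ 15 ∷ 17 ∷ 18 ∷ 20 ∷ 22 ∷ 23 ∷ [])) (n ∸ 4))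
    × ((n : ℕ) → 3 ≤ n →
      p (pmSet 48 (3 ∷ 4 ∷ 5 ∷ 6 ∷ 7 ∷ 11 ∷ 13 ∷ 14 ∷ 17 ∷ 19 ∷ 20 ∷ 21 ∷ [])) n
        ≡ p (pmSet 48 (1 ∷ 3 ∷ 7 ∷ 8 ∷ 11 ∷ 13 ∷ 14 ∷ 17 ∷ 18 ∷ 20 ∷ 21 ∷ 23 ∷ [])) (n ∸ 3))
theorem7p5 =
    shifted-partitions-∸ {S₁} {T₁} (residues refl refl) (residues refl refl) (λ M → identity₁ (truncated M) variable-X M (Xᴹ≈0 M))
  , shifted-partitions {S₂} {T₂} (residues refl refl) (residues refl refl) (λ M → identity₂ (truncated M) variable-X M (Xᴹ≈0 M))
  , shifted-partitions-∸ {S₃} {T₃} (residues refl refl) (residues refl refl) (λ M → identity₃ (truncated M) variable-X M (Xᴹ≈0 M))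
  , shifted-partitions-∸ {S₄} {T₄} (residues refl refl) (residues refl refl) (λ M → identity₄ (truncated M) variable-X M (Xᴹ≈0 M))
  where open Identities
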